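{- There is a one-pass randomized streaming algorithm that, on interaction sequences $\sigma$ of length $N$ over universe $[U]$, uses $O(\sqrt{N}(\log U+\log N))$ bits of space and recognizes the language $\mathrm{PQ}=\mathrm{PQ}(U)$ in the following sense: every input $\sigma\in\mathrm{PQ}$ is accepted with certainty, and every input $\sigma\notin\mathrm{PQ}$ is rejected with probability at least $1-1/N^2$.
   Context: A one-pass streaming algorithm reads its input sequentially, symbol by symbol, once from left to right, using a bounded working memory (measured in bits), and may use randomness. $\mathrm{PQ}(U)$: an interaction sequence $\sigma=\sigma_1\cdots\sigma_N$ is a string over $\Sigma=\{\mathrm{ins}(u),\mathrm{ext}(u):u\in[U]\}$. Define multisets $M_0=\emptyset$; $M_j=M_{j-1}\cup\{u\}$ if $\sigma_j=\mathrm{ins}(u)$; $M_j=M_{j-1}\setminus\{\min(M_{j-1})\}$ if $\sigma_j=\mathrm{ext}(v)$ (multiset operations, one copy added or removed). Then $\sigma\in\mathrm{PQ}(U)$ iff $M_N=\emptyset$ and for every $j\in[N]$, $\sigma_j=\mathrm{ext}(u)$ implies $u=\min(M_{j-1})$ (in particular $M_{j-1}\neq\emptyset$). The length $N$ and universe size $U$ are known to the algorithm. -}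

module Defs where

open import Data.Bool using (Bool; true; false; if_then_else_)
open import Data.Fin using (Fin; zero; suc; toℕ)
open import Data.Integer using (+_)
open import Data.List as List using (List)
open import Data.Maybe as Maybe using (Maybe; just; nothing)
open import Data.Nat using (ℕ; zero; suc; pred; _+_; _*_; _^_; _≤_)
open import Data.Nat.Properties using (m^n≢0)
open import Data.Product using (_×_)
open import Data.Rational.Unnormalised using (ℚᵘ; _/_)
open import Data.Vec using (Vec; []; _∷_; lookup; replicate; updateAt; take; drop; toList)
open import Function using (_∘_)
open import Relation.Binary.PropositionalEquality using (_≡_)

infix 4 _≤_·√_

-- a ≤ b · √ n over the reals, squared to stay in ℕ.
_≤_·√_ : ℕ → ℕ → ℕ → Set
a ≤ b ·√ n = a ^ 2 ≤ b ^ 2 * n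

-- The universe [U] is represented by Fin U, with its usual order.
data Symbol (U : ℕ) : Set where
  ins ext : Fin U → Symbol U

-- A multiset over [U], given by the multiplicity of each element.
Multiset : ℕ → Set
Multiset U = Vec ℕ U

∅ : ∀ {U} → Multiset U
∅ = replicate _ 0

min : ∀ {U} → Multiset U → Maybe (Fin U)
min []          = nothing
min (zero  ∷ M) = Maybe.map suc (min M)
min (suc _ ∷ M) = just zero

insert : ∀ {U} → Fin U → Multiset U → Multiset U
insert u M = updateAt M u suc

-- The empty multiset is left unchanged. This convention has no effect on PQ,
-- where an extraction from the empty multiset already violates membership.
deleteMin : ∀ {U} → Multiset U → Multiset U
deleteMin M = Maybe.maybe′ (λ u → updateAt M u pred) M (min M)

-- An extraction removes the minimum, whether or not it is the element named.
update : ∀ {U} → Multiset U → Symbol U → Multiset U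
update M (ins u) = insert u M
update M (ext _) = deleteMin M

-- contents σ j is M_j, the multiset after the first j symbols.
contents : ∀ {U N} → Vec (Symbol U) N → ℕ → Multiset U
contents σ j = List.foldl update ∅ (List.take j (toList σ))

-- Positions are counted from 0 here, so the multiset before the symbol at
-- position j is contents σ (toℕ j).
PQ : ∀ {U N} → Vec (Symbol U) N → Set
PQ {U} {N} σ =
  contents σ N ≡ ∅ ×
  (∀ (j : Fin N) (u : Fin U) →
     lookup σ j ≡ ext u → min (contents σ (toℕ j)) ≡ just u)

count : ∀ {n} → (Vec Bool n → Bool) → ℕ
count {zero}  E = if E [] then 1 else 0
count {suc n} E = count (E ∘ (false ∷_)) + count (E ∘ (true ∷_))

Pr : ∀ {n} → (Vec Bool n → Bool) → ℚᵘ
Pr {n} E = _/_ (+ count E) (2 ^ n) {{m^n≢0 2 n}}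

-- The working memory is a string of `memory` bits. Fresh coins are flipped
-- at initialization and at each symbol read; they are lost afterwards unless
-- stored in memory. No step sees the position in the input.
record StreamingAlgorithm (A : Set) : Set where
  field
    memory : ℕ
    coins  : ℕ
    start  : Vec Bool coins → Vec Bool memory
    step   : Vec Bool coins → Vec Bool memory → A → Vec Bool memory
    accept : Vec Bool memory → Bool

  -- The coins in use are charged along with the memory.
  space : ℕ
  space = memory + coins

  runFrom : ∀ {N} → Vec Bool memory → Vec A N → Vec Bool (N * coins) → Bool
  runFrom m []      r = accept m
  runFrom m (a ∷ σ) r = runFrom (step (take coins r) m a) σ (drop coins r)

  -- The output on σ (true meaning accept) for the coin outcomes r.
  run : ∀ {N} → Vec A N → Vec Bool (suc N * coins) → Bool
  run σ r = runFrom (start (take coins r)) σ (drop coins r)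

{-# OPTIONS --safe #-}
module Submission where

-- The input is cut into blocks of length B ≈ √N. Only the maximum extracted in
-- each block is stored. The tag of u is the last block in which something
-- larger than u was extracted; at that moment no copy of u may be left, so for
-- each pair (u, tag) as many copies must be extracted as were inserted.
-- The copies inserted in the current block are kept explicitly and move to a
-- fingerprint of the pairs at its end; an extraction uses the explicit copies
-- first and is otherwise charged to a second fingerprint. Equal totals alone
-- would allow a charge to precede the insertion that pays for it. A charged u
-- is therefore pinned, being the maximum of its block: until something larger
-- is extracted, its copies stay explicit and can no longer pay for the charge.
-- At most one element per block is pinned.
-- The fingerprint is a random multilinear polynomial over ℕ, with one variable
-- for each bit of a pair.

open import Defs
open import Data.Bool using (Bool; true; false; not; if_then_else_; _∧_; T)
open import Data.Empty using (⊥-elim)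
open import Data.Fin as Fin using (Fin; zero; suc; toℕ; fromℕ<)
import Data.Fin.Properties as Fin
open import Data.List as List using (List; []; _∷_; length)
open import Data.List.Membership.Propositional using (_∈_; _∉_)
open import Data.List.Membership.Propositional.Properties using (∈-++⁺ˡ; ∈-++⁺ʳ)
open import Data.List.Properties using (length-map; map-++; map-id; map-∘)
open import Data.List.Relation.Unary.All as All using (All; []; _∷_)
import Data.List.Relation.Unary.All.Properties as All
open import Data.List.Relation.Unary.Any using (here; there)
open import Data.Maybe as Maybe using (Maybe; just; nothing; _>>=_)
open import Data.Nat hiding (_/_)
open import Data.Nat.Logarithm using (⌊log₂_⌋; ⌊log₂⌋-mono-≤; ⌊log₂[2^n]⌋≡n; ⌊log₂⌊n/2⌋⌋≡⌊log₂n⌋∸1)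
open import Data.Nat.Properties
open import Data.Nat.Solver using (module +-*-Solver)
open import Data.Product using (Σ; ∃; ∃-syntax; _×_; _,_; proj₁; proj₂)
open import Data.Sum using (_⊎_; inj₁; inj₂)
open import Data.Unit using (⊤)
open import Data.Vec as Vec using (Vec; []; _∷_; _++_; lookup; tabulate; updateAt; replicate; take; drop; toList)
open import Data.Vec.Properties using (∷-injectiveʳ; ≡-dec; lookup∘updateAt; lookup∘updateAt′; lookup∘tabulate; lookup-replicate; tabulate∘lookup; tabulate-cong; take++drop≡id)
open import Function using (_∘_)
open import Relation.Binary.Definitions using (tri<; tri≈; tri>)
open import Relation.Binary.PropositionalEquality
open import Relation.Nullary using (¬_; Dec; yes; no; does; contradiction)
open import Relation.Nullary.Decidable using (dec-true; dec-false; _×-dec_; _→-dec_; ¬?)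
open +-*-Solver using (solve; _:=_; _:+_; _:*_; con)
open StreamingAlgorithm

-- The fingerprints are compared once, after the last symbol, while a wrong extraction may occur
-- early, so a final equality has to be carried back in time. This works for entries that can no
-- longer change: once an extraction has charged an entry, that entry receives no further spills,
-- and the entries that smaller elements leave behind receive nothing at all. The analysis runs on
-- exact ledgers. The control never reads a fingerprint and fingerprints are additive, so the
-- algorithm's run is an image of the exact run. In particular the final ledgers do not depend on
-- the coins, and randomness enters only in the comparison of two fixed polynomials. With one
-- variable per key bit, instead of one variable whose degree grows with U, the number of sample
-- points per variable is independent of U: the error is at most the total charge, hence at most N,
-- divided by 2^b, and b of order 3 log N suffices. The coins then number O((log U + log N) log N),
-- which fits the space bound since log N = O(√N).

fromBits : ∀ {w} → Vec Bool w → ℕ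
fromBits []                  = 0
fromBits {suc w} (true ∷ v)  = 2 ^ w + fromBits v
fromBits {suc w} (false ∷ v) = fromBits v

toBits : ∀ w → ℕ → Vec Bool w
toBits zero    n = []
toBits (suc w) n with 2 ^ w ≤? n
... | yes _ = true ∷ toBits w (n ∸ 2 ^ w)
... | no  _ = false ∷ toBits w n

2*m≡m+m : ∀ m → 2 * m ≡ m + m
2*m≡m+m m = cong (m +_) (+-identityʳ m)

fromBits<2^w : ∀ {w} (v : Vec Bool w) → fromBits v < 2 ^ w
fromBits<2^w []                  = s≤s z≤n
fromBits<2^w {suc w} (true ∷ v)  =
  <-≤-trans (+-monoʳ-< (2 ^ w) (fromBits<2^w v)) (≤-reflexive (sym (2*m≡m+m (2 ^ w))))
fromBits<2^w {suc w} (false ∷ v) =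
  <-≤-trans (fromBits<2^w v) (m≤m+n (2 ^ w) _)

fromBits-toBits : ∀ w {n} → n < 2 ^ w → fromBits (toBits w n) ≡ n
fromBits-toBits zero    n<1 = sym (n<1⇒n≡0 n<1)
fromBits-toBits (suc w) {n} n<2^w with 2 ^ w ≤? n
... | yes 2^w≤n = trans (cong (2 ^ w +_) (fromBits-toBits w
        (+-cancelˡ-< (2 ^ w) _ _ (subst₂ _<_ (sym (m+[n∸m]≡n 2^w≤n)) (2*m≡m+m (2 ^ w)) n<2^w))))
        (m+[n∸m]≡n 2^w≤n)
... | no 2^w≰n = fromBits-toBits w (≰⇒> 2^w≰n)

toBits-fromBits : ∀ {w} (v : Vec Bool w) → toBits w (fromBits v) ≡ v
toBits-fromBits [] = refl
toBits-fromBits {suc w} (true ∷ v) with 2 ^ w ≤? 2 ^ w + fromBits v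
... | yes _ = cong (true ∷_) (trans (cong (toBits w) (m+n∸m≡n (2 ^ w) _)) (toBits-fromBits v))
... | no ¬p = contradiction (m≤m+n (2 ^ w) _) ¬p
toBits-fromBits {suc w} (false ∷ v) with 2 ^ w ≤? fromBits v
... | yes p = contradiction p (<⇒≱ (fromBits<2^w v))
... | no _  = cong (false ∷_) (toBits-fromBits v)

fromBits-injective : ∀ {w} {v v′ : Vec Bool w} → fromBits v ≡ fromBits v′ → v ≡ v′
fromBits-injective {w} {v} {v′} eq =
  trans (sym (toBits-fromBits v)) (trans (cong (toBits w) eq) (toBits-fromBits v′))

take-++ : ∀ {A : Set} {m n} (xs : Vec A m) (ys : Vec A n) → take m (xs ++ ys) ≡ xs
take-++ []       ys = refl
take-++ (x ∷ xs) ys = cong (x ∷_) (take-++ xs ys)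

drop-++ : ∀ {A : Set} {m n} (xs : Vec A m) (ys : Vec A n) → drop m (xs ++ ys) ≡ ys
drop-++ []       ys = refl
drop-++ (x ∷ xs) ys = drop-++ xs ys

-- Sums over bit strings

sum : ∀ {n} → (Vec Bool n → ℕ) → ℕ
sum {zero}  f = f []
sum {suc n} f = sum (f ∘ (false ∷_)) + sum (f ∘ (true ∷_))

indicator : Bool → ℕ
indicator b = if b then 1 else 0

indicator-≤1 : ∀ b → indicator b ≤ 1
indicator-≤1 true  = ≤-refl
indicator-≤1 false = z≤n

indicator-≡ᵇ : ∀ {m n} → 0 < indicator (m ≡ᵇ n) → m ≡ n
indicator-≡ᵇ {m} {n} p with m ≡ᵇ n in eq
... | true = ≡ᵇ⇒≡ m n (subst T (sym eq) _)

indicator-mono : ∀ {m n m′ n′} → (m ≡ n → m′ ≡ n′) → indicator (m ≡ᵇ n) ≤ indicator (m′ ≡ᵇ n′)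
indicator-mono {m} {n} {m′} {n′} implies with m ≡ᵇ n in eq
... | false = z≤n
... | true with m′ ≡ᵇ n′ in eq′
...   | true  = ≤-refl
...   | false = ⊥-elim (subst T eq′ (≡⇒≡ᵇ m′ n′ (implies (≡ᵇ⇒≡ m n (subst T (sym eq) _)))))

count≡sum : ∀ {n} (E : Vec Bool n → Bool) → count E ≡ sum (indicator ∘ E)
count≡sum {zero}  E = refl
count≡sum {suc n} E = cong₂ _+_ (count≡sum (E ∘ (false ∷_))) (count≡sum (E ∘ (true ∷_)))

sum-mono : ∀ {n} {f g : Vec Bool n → ℕ} → (∀ x → f x ≤ g x) → sum f ≤ sum g
sum-mono {zero}  f≤g = f≤g []
sum-mono {suc n} f≤g = +-mono-≤ (sum-mono (f≤g ∘ (false ∷_))) (sum-mono (f≤g ∘ (true ∷_)))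

≤-sum : ∀ {n} (f : Vec Bool n → ℕ) x → f x ≤ sum f
≤-sum f []          = ≤-refl
≤-sum f (false ∷ x) = ≤-trans (≤-sum (f ∘ (false ∷_)) x) (m≤m+n _ _)
≤-sum f (true ∷ x)  = ≤-trans (≤-sum (f ∘ (true ∷_)) x) (m≤n+m _ _)

sum-cong : ∀ {n} {f g : Vec Bool n → ℕ} → f ≗ g → sum f ≡ sum g
sum-cong f≗g = ≤-antisym (sum-mono (≤-reflexive ∘ f≗g)) (sum-mono (≤-reflexive ∘ sym ∘ f≗g))

sum-+ : ∀ {n} (f g : Vec Bool n → ℕ) → sum (λ x → f x + g x) ≡ sum f + sum g
sum-+ {zero}  f g = refl
sum-+ {suc n} f g = trans
  (cong₂ _+_ (sum-+ (f ∘ (false ∷_)) (g ∘ (false ∷_))) (sum-+ (f ∘ (true ∷_)) (g ∘ (true ∷_))))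
  (solve 4 (λ a b c d → (a :+ b) :+ (c :+ d) := (a :+ c) :+ (b :+ d)) refl
    (sum (f ∘ (false ∷_))) (sum (g ∘ (false ∷_))) (sum (f ∘ (true ∷_))) (sum (g ∘ (true ∷_))))

sum-const : ∀ n c → sum {n} (λ _ → c) ≡ 2 ^ n * c
sum-const zero    c = sym (+-identityʳ c)
sum-const (suc n) c = trans (cong₂ _+_ (sum-const n c) (sum-const n c))
  (trans (sym (*-distribʳ-+ c (2 ^ n) (2 ^ n))) (cong (_* c) (sym (2*m≡m+m (2 ^ n)))))

sum-*ˡ : ∀ {n} c (f : Vec Bool n → ℕ) → sum (λ x → c * f x) ≡ c * sum f
sum-*ˡ {zero}  c f = refl
sum-*ˡ {suc n} c f = trans (cong₂ _+_ (sum-*ˡ c (f ∘ (false ∷_))) (sum-*ˡ c (f ∘ (true ∷_))))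
  (sym (*-distribˡ-+ c _ _))

sum-++ : ∀ m {n} (f : Vec Bool (m + n) → ℕ) →
         sum f ≡ sum {m} (λ x → sum {n} (λ y → f (x ++ y)))
sum-++ zero    f = refl
sum-++ (suc m) f = cong₂ _+_ (sum-++ m (f ∘ (false ∷_))) (sum-++ m (f ∘ (true ∷_)))

sum-swap : ∀ m n (f : Vec Bool m → Vec Bool n → ℕ) →
           sum (λ x → sum (f x)) ≡ sum (λ y → sum (λ x → f x y))
sum-swap zero    n f = refl
sum-swap (suc m) n f = trans
  (cong₂ _+_ (sum-swap m n (f ∘ (false ∷_))) (sum-swap m n (f ∘ (true ∷_))))
  (sym (sum-+ {n} _ _))

sum-zero-or-positive : ∀ {n} (f : Vec Bool n → ℕ) → sum f ≡ 0 ⊎ ∃ λ x → 0 < f x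
sum-zero-or-positive {zero} f with f [] in eq
... | zero  = inj₁ refl
... | suc k = inj₂ ([] , subst (0 <_) (sym eq) (s≤s z≤n))
sum-zero-or-positive {suc n} f with sum-zero-or-positive (f ∘ (false ∷_)) | sum-zero-or-positive (f ∘ (true ∷_))
... | inj₂ (x , 0<f) | _              = inj₂ (_ , 0<f)
... | inj₁ _         | inj₂ (x , 0<f) = inj₂ (_ , 0<f)
... | inj₁ f≡0       | inj₁ g≡0       = inj₁ (cong₂ _+_ f≡0 g≡0)

sum-≤1 : ∀ {n} {f : Vec Bool n → ℕ} → (∀ x → f x ≤ 1) →
         (∀ x y → 0 < f x → 0 < f y → x ≡ y) → sum f ≤ 1
sum-≤1 {zero}  f≤1 unique = f≤1 []
sum-≤1 {suc n} {f} f≤1 unique with sum-≤1 {n} (f≤1 ∘ (false ∷_)) (λ x y p q → ∷-injectiveʳ (unique _ _ p q))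
                                 | sum-≤1 {n} (f≤1 ∘ (true ∷_)) (λ x y p q → ∷-injectiveʳ (unique _ _ p q))
... | p | q with sum-zero-or-positive (f ∘ (false ∷_)) | sum-zero-or-positive (f ∘ (true ∷_))
... | inj₁ f≡0       | _              = subst (λ s → s + sum (f ∘ (true ∷_)) ≤ 1) (sym f≡0) q
... | inj₂ _         | inj₁ g≡0       =
  subst (λ s → sum (f ∘ (false ∷_)) + s ≤ 1) (sym g≡0) (subst (_≤ 1) (sym (+-identityʳ _)) p)
... | inj₂ (x , 0<f) | inj₂ (y , 0<g) with () ← unique _ _ 0<f 0<g

-- Only the coins flipped at initialization influence the checker; this removes the later ones from
-- the count.
count-take : ∀ m {n} (E : Vec Bool m → Bool) → count {m + n} (E ∘ take m) ≡ 2 ^ n * count E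
count-take m {n} E = begin
  count {m + n} (E ∘ take m)                                         ≡⟨ count≡sum {m + n} _ ⟩
  sum {m + n} (λ z → indicator (E (take m z)))                       ≡⟨ sum-++ m _ ⟩
  sum {m} (λ x → sum {n} (λ y → indicator (E (take m (x ++ y)))))
    ≡⟨ sum-cong {m} (λ x → sum-cong {n} (λ y → cong (indicator ∘ E) (take-++ x y))) ⟩
  sum {m} (λ x → sum {n} (λ y → indicator (E x)))                    ≡⟨ sum-cong {m} (λ x → sum-const n (indicator (E x))) ⟩
  sum {m} (λ x → 2 ^ n * indicator (E x))                            ≡⟨ sum-*ˡ {m} (2 ^ n) (indicator ∘ E) ⟩
  2 ^ n * sum (indicator ∘ E)                                        ≡⟨ cong (2 ^ n *_) (count≡sum E) ⟨
  2 ^ n * count E                                                    ∎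
  where open ≡-Reasoning

count-cong : ∀ {n} {E E′ : Vec Bool n → Bool} → E ≗ E′ → count E ≡ count E′
count-cong {zero}  E≗E′ = cong indicator (E≗E′ [])
count-cong {suc n} E≗E′ = cong₂ _+_ (count-cong (E≗E′ ∘ (false ∷_))) (count-cong (E≗E′ ∘ (true ∷_)))

count-false : ∀ n → count {n} (λ _ → false) ≡ 0
count-false zero    = refl
count-false (suc n) = cong₂ _+_ (count-false n) (count-false n)

-- Fingerprints

-- F gives the coefficients of a multilinear polynomial in ℓ variables, which is
-- evaluated at the point of [1, 2^b]^ℓ read off r. Excluding 0 keeps differences
-- between coefficients visible.
eval : ∀ {b} ℓ → Vec Bool (ℓ * b) → (Vec Bool ℓ → ℕ) → ℕ
eval         zero    r F = F []
eval {b = b} (suc ℓ) r F =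
  eval ℓ (drop b r) (F ∘ (false ∷_)) +
  suc (fromBits (take b r)) * eval ℓ (drop b r) (F ∘ (true ∷_))

eval-cong : ∀ {b} ℓ (r : Vec Bool (ℓ * b)) {F G} → F ≗ G → eval ℓ r F ≡ eval ℓ r G
eval-cong         zero    r F≗G = F≗G []
eval-cong {b = b} (suc ℓ) r F≗G = cong₂ (λ x y → x + suc (fromBits (take b r)) * y)
  (eval-cong ℓ _ (F≗G ∘ (false ∷_))) (eval-cong ℓ _ (F≗G ∘ (true ∷_)))

eval-+ : ∀ {b} ℓ (r : Vec Bool (ℓ * b)) F G →
         eval ℓ r (λ x → F x + G x) ≡ eval ℓ r F + eval ℓ r G
eval-+         zero    r F G = refl
eval-+ {b = b} (suc ℓ) r F G = trans
  (cong₂ (λ x y → x + suc (fromBits (take b r)) * y) (eval-+ ℓ _ _ _) (eval-+ ℓ _ _ _))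
  (solve 5 (λ s u v x y → (u :+ v) :+ s :* (x :+ y) := (u :+ s :* x) :+ (v :+ s :* y)) refl
    (suc (fromBits (take b r))) (eval ℓ (drop b r) (F ∘ (false ∷_))) (eval ℓ (drop b r) (G ∘ (false ∷_)))
    (eval ℓ (drop b r) (F ∘ (true ∷_))) (eval ℓ (drop b r) (G ∘ (true ∷_))))

-- Each variable has value at most 2^b and so contributes a factor of at most 1 + 2^b ≤ 2^(b+1). The
-- bound determines the width reserved for a fingerprint.
eval-≤ : ∀ {b} ℓ (r : Vec Bool (ℓ * b)) {F c} → (∀ x → F x ≤ c) → eval ℓ r F ≤ c * 2 ^ (ℓ * suc b)
eval-≤         zero    r {c = c} F≤c = ≤-trans (F≤c []) (≤-reflexive (sym (*-identityʳ c)))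
eval-≤ {b = b} (suc ℓ) r {F} {c} F≤c = begin
  eval ℓ (drop b r) (F ∘ (false ∷_)) + suc x * eval ℓ (drop b r) (F ∘ (true ∷_))
    ≤⟨ +-mono-≤ (eval-≤ ℓ _ (F≤c ∘ (false ∷_))) (*-monoʳ-≤ (suc x) (eval-≤ ℓ _ (F≤c ∘ (true ∷_)))) ⟩
  suc (suc x) * (c * W)          ≤⟨ *-monoˡ-≤ (c * W) 2+x≤2^[1+b] ⟩
  2 ^ suc b * (c * W)            ≡⟨ solve 3 (λ p c w → p :* (c :* w) := c :* (p :* w)) refl (2 ^ suc b) c W ⟩
  c * (2 ^ suc b * W)            ≡⟨ cong (c *_) (^-distribˡ-+-* 2 (suc b) (ℓ * suc b)) ⟨
  c * 2 ^ (suc ℓ * suc b)        ∎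
  where
  open ≤-Reasoning
  x = fromBits (take b r)
  W = 2 ^ (ℓ * suc b)
  2+x≤2^[1+b] : suc (suc x) ≤ 2 ^ suc b
  2+x≤2^[1+b] = begin
    suc (suc x)   ≤⟨ s≤s (fromBits<2^w (take b r)) ⟩
    1 + 2 ^ b     ≤⟨ +-monoˡ-≤ (2 ^ b) (m^n>0 2 b) ⟩
    2 ^ b + 2 ^ b ≡⟨ 2*m≡m+m (2 ^ b) ⟨
    2 ^ suc b     ∎

-- The difference of the two equations is a positive multiple of the slopes. To stay in ℕ, `a′` is
-- written as `suc a + e` and the common part is cancelled.
lines-meet-once : ∀ {c₀ c₁ d₀ d₁} a a′ →
  c₀ + a * c₁ ≡ d₀ + a * d₁ → c₀ + a′ * c₁ ≡ d₀ + a′ * d₁ → a < a′ → c₀ ≡ d₀ × c₁ ≡ d₁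
lines-meet-once {c₀} {c₁} {d₀} {d₁} a a′ eq eq′ a<a′ with m≤n⇒∃[o]m+o≡n a<a′
... | e , refl = +-cancelʳ-≡ (a * d₁) c₀ d₀ (subst (λ z → c₀ + a * z ≡ d₀ + a * d₁) c₁≡d₁ eq) , c₁≡d₁
  where
  regroup : ∀ c₀ c₁ → c₀ + a * c₁ + suc e * c₁ ≡ c₀ + (suc a + e) * c₁
  regroup c₀ c₁ = solve 4
    (λ c₀ c₁ a e → c₀ :+ a :* c₁ :+ (con 1 :+ e) :* c₁ := c₀ :+ (con 1 :+ a :+ e) :* c₁) refl c₀ c₁ a e
  c₁≡d₁ : c₁ ≡ d₁
  c₁≡d₁ = *-cancelˡ-≡ c₁ d₁ (suc e) (+-cancelˡ-≡ (d₀ + a * d₁) _ _ (begin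
    d₀ + a * d₁ + suc e * c₁   ≡⟨ cong (_+ suc e * c₁) eq ⟨
    c₀ + a * c₁ + suc e * c₁   ≡⟨ regroup c₀ c₁ ⟩
    c₀ + (suc a + e) * c₁      ≡⟨ eq′ ⟩
    d₀ + (suc a + e) * d₁      ≡⟨ regroup d₀ d₁ ⟨
    d₀ + a * d₁ + suc e * d₁   ∎))
    where open ≡-Reasoning

collisions-≤1 : ∀ {b c₀ c₁ d₀ d₁} → ¬ (c₀ ≡ d₀ × c₁ ≡ d₁) →
  sum {b} (λ h → indicator (c₀ + suc (fromBits h) * c₁ ≡ᵇ d₀ + suc (fromBits h) * d₁)) ≤ 1
collisions-≤1 {b} {c₀} {c₁} {d₀} {d₁} differ = sum-≤1 (indicator-≤1 ∘ E) unique
  where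
  E : Vec Bool b → Bool
  E h = c₀ + suc (fromBits h) * c₁ ≡ᵇ d₀ + suc (fromBits h) * d₁
  unique : ∀ x y → 0 < indicator (E x) → 0 < indicator (E y) → x ≡ y
  unique x y p q with <-cmp (fromBits x) (fromBits y)
  ... | tri≈ _ x≡y _ = fromBits-injective x≡y
  ... | tri< x<y _ _ = ⊥-elim (differ (lines-meet-once {c₀} _ _ (indicator-≡ᵇ p) (indicator-≡ᵇ q) (s≤s x<y)))
  ... | tri> _ _ y<x = ⊥-elim (differ (lines-meet-once {c₀} _ _ (indicator-≡ᵇ q) (indicator-≡ᵇ p) (s≤s y<x)))

-- Schwartz–Zippel for multilinear polynomials over ℕ. A coin-dependent coefficient
-- can only create a coincidence in addition to those of one half of the keys, so
-- the error grows with the mass of G and not with the number ℓ of variables.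
fingerprint-error : ∀ {b} ℓ (F G : Vec Bool ℓ → ℕ) →
  F ≗ G ⊎ count {ℓ * b} (λ r → eval ℓ r F ≡ᵇ eval ℓ r G) * 2 ^ b ≤ sum G * 2 ^ (ℓ * b)
fingerprint-error {b} zero F G with F [] ≟ G []
... | yes F≡G = inj₁ (λ { [] → F≡G })
... | no  F≢G with F [] ≡ᵇ G [] in eq
...   | false = inj₂ z≤n
...   | true  = ⊥-elim (F≢G (≡ᵇ⇒≡ _ _ (subst T (sym eq) _)))
fingerprint-error {b} (suc ℓ) F G = combine (fingerprint-error ℓ F₀ G₀) (fingerprint-error ℓ F₁ G₁)
  where
  F₀ = F ∘ (false ∷_)
  F₁ = F ∘ (true ∷_)
  G₀ = G ∘ (false ∷_)
  G₁ = G ∘ (true ∷_)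
  Z = 2 ^ (ℓ * b)

  E : ∀ ℓ′ (F G : Vec Bool ℓ′ → ℕ) → Vec Bool (ℓ′ * b) → Bool
  E ℓ′ F G r = eval ℓ′ r F ≡ᵇ eval ℓ′ r G

  value : (Vec Bool ℓ → ℕ) → (Vec Bool ℓ → ℕ) → Vec Bool b → Vec Bool (ℓ * b) → ℕ
  value F₀ F₁ h r = eval ℓ r F₀ + suc (fromBits h) * eval ℓ r F₁

  fibre : Vec Bool (ℓ * b) → ℕ
  fibre r = sum (λ h → indicator (value F₀ F₁ h r ≡ᵇ value G₀ G₁ h r))

  count≡fibres : count (E (suc ℓ) F G) ≡ sum fibre
  count≡fibres = begin
    count (E (suc ℓ) F G)                                               ≡⟨ count≡sum {suc ℓ * b} _ ⟩
    sum (indicator ∘ E (suc ℓ) F G)                                     ≡⟨ sum-++ b _ ⟩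
    sum {b} (λ h → sum (λ r → indicator (E (suc ℓ) F G (h ++ r))))
      ≡⟨ sum-cong {b} (λ h → sum-cong {ℓ * b} (λ r → cong₂ (λ h r → indicator (value F₀ F₁ h r ≡ᵇ value G₀ G₁ h r))
           (take-++ h r) (drop-++ h r))) ⟩
    sum {b} (λ h → sum (λ r → indicator (value F₀ F₁ h r ≡ᵇ value G₀ G₁ h r)))
      ≡⟨ sum-swap b (ℓ * b) _ ⟩
    sum fibre                                                           ∎
    where open ≡-Reasoning

  scale : ∀ c m → c * 2 ^ b ≤ m * Z → 2 ^ b * c * 2 ^ b ≤ m * 2 ^ (suc ℓ * b)
  scale c m bound = begin
    2 ^ b * c * 2 ^ b     ≡⟨ *-assoc (2 ^ b) c (2 ^ b) ⟩
    2 ^ b * (c * 2 ^ b)   ≤⟨ *-monoʳ-≤ (2 ^ b) bound ⟩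
    2 ^ b * (m * Z)       ≡⟨ solve 3 (λ p m z → p :* (m :* z) := m :* (p :* z)) refl (2 ^ b) m Z ⟩
    m * (2 ^ b * Z)       ≡⟨ cong (m *_) (^-distribˡ-+-* 2 b (ℓ * b)) ⟨
    m * 2 ^ (suc ℓ * b)   ∎
    where open ≤-Reasoning

  -- When a coincidence at (h, r) forces one at r alone, a fibre is at most 2^b times an indicator,
  -- and the induction hypothesis carries over without loss.
  constant-fibres : ∀ (F′ G′ : Vec Bool ℓ → ℕ) →
    (∀ h r → value F₀ F₁ h r ≡ value G₀ G₁ h r → eval ℓ r F′ ≡ eval ℓ r G′) →
    ∀ {m} → count (E ℓ F′ G′) * 2 ^ b ≤ sum G′ * Z → sum G′ ≤ m →
    count (E (suc ℓ) F G) * 2 ^ b ≤ m * 2 ^ (suc ℓ * b)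
  constant-fibres F′ G′ implies {m} bound mass = begin
    count (E (suc ℓ) F G) * 2 ^ b                          ≡⟨ cong (_* 2 ^ b) count≡fibres ⟩
    sum fibre * 2 ^ b
      ≤⟨ *-monoˡ-≤ (2 ^ b) (sum-mono {ℓ * b} (λ r → sum-mono {b} (λ h → indicator-mono (implies h r)))) ⟩
    sum (λ r → sum {b} (λ h → indicator (E ℓ F′ G′ r))) * 2 ^ b
      ≡⟨ cong (_* 2 ^ b) (trans (sum-cong {ℓ * b} (λ r → sum-const b (indicator (E ℓ F′ G′ r)))) (sum-*ˡ {ℓ * b} (2 ^ b) (indicator ∘ E ℓ F′ G′))) ⟩
    2 ^ b * sum (indicator ∘ E ℓ F′ G′) * 2 ^ b
      ≡⟨ cong (λ z → 2 ^ b * z * 2 ^ b) (count≡sum (E ℓ F′ G′)) ⟨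
    2 ^ b * count (E ℓ F′ G′) * 2 ^ b                      ≤⟨ scale _ m (≤-trans bound (*-monoˡ-≤ Z mass)) ⟩
    m * 2 ^ (suc ℓ * b)                                    ∎
    where open ≤-Reasoning

  -- If the coefficients disagree at r, two distinct lines meet for at most one h; if they agree,
  -- the indicator covers the whole fibre. The extra 1 per fibre costs exactly one unit of mass.
  one-extra : ∀ (F′ G′ : Vec Bool ℓ → ℕ) →
    (∀ r → eval ℓ r F₀ ≡ eval ℓ r G₀ × eval ℓ r F₁ ≡ eval ℓ r G₁ → eval ℓ r F′ ≡ eval ℓ r G′) →
    ∀ {m} → count (E ℓ F′ G′) * 2 ^ b ≤ sum G′ * Z → suc (sum G′) ≤ m →
    count (E (suc ℓ) F G) * 2 ^ b ≤ m * 2 ^ (suc ℓ * b)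
  one-extra F′ G′ implies {m} bound mass = begin
    count (E (suc ℓ) F G) * 2 ^ b                          ≡⟨ cong (_* 2 ^ b) count≡fibres ⟩
    sum fibre * 2 ^ b                                      ≤⟨ *-monoˡ-≤ (2 ^ b) (sum-mono {ℓ * b} fibre-≤) ⟩
    sum (λ r → 1 + 2 ^ b * indicator (E ℓ F′ G′ r)) * 2 ^ b
      ≡⟨ cong (_* 2 ^ b) (sum-+ {ℓ * b} (λ _ → 1) (λ r → 2 ^ b * indicator (E ℓ F′ G′ r))) ⟩
    (sum {ℓ * b} (λ _ → 1) + sum (λ r → 2 ^ b * indicator (E ℓ F′ G′ r))) * 2 ^ b
      ≡⟨ cong₂ (λ u v → (u + v) * 2 ^ b) (sum-const (ℓ * b) 1)
           (trans (sum-*ˡ {ℓ * b} (2 ^ b) (indicator ∘ E ℓ F′ G′)) (cong (2 ^ b *_) (sym (count≡sum (E ℓ F′ G′))))) ⟩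
    (Z * 1 + 2 ^ b * count (E ℓ F′ G′)) * 2 ^ b
      ≡⟨ *-distribʳ-+ (2 ^ b) (Z * 1) _ ⟩
    Z * 1 * 2 ^ b + 2 ^ b * count (E ℓ F′ G′) * 2 ^ b      ≤⟨ +-mono-≤ (≤-reflexive Z*1*2^b) (scale _ (sum G′) bound) ⟩
    2 ^ (suc ℓ * b) + sum G′ * 2 ^ (suc ℓ * b)             ≤⟨ *-monoˡ-≤ (2 ^ (suc ℓ * b)) mass ⟩
    m * 2 ^ (suc ℓ * b)                                    ∎
    where
    open ≤-Reasoning
    Z*1*2^b : Z * 1 * 2 ^ b ≡ 2 ^ (suc ℓ * b)
    Z*1*2^b = trans (solve 2 (λ z p → z :* con 1 :* p := p :* z) refl Z (2 ^ b)) (sym (^-distribˡ-+-* 2 b (ℓ * b)))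
    fibre-≤ : ∀ r → fibre r ≤ 1 + 2 ^ b * indicator (E ℓ F′ G′ r)
    fibre-≤ r with eval ℓ r F₀ ≟ eval ℓ r G₀ | eval ℓ r F₁ ≟ eval ℓ r G₁
    ... | no ≢₀  | _      = ≤-trans (collisions-≤1 {b} {d₀ = eval ℓ r G₀} (≢₀ ∘ proj₁)) (m≤m+n 1 _)
    ... | yes _  | no ≢₁  = ≤-trans (collisions-≤1 {b} {eval ℓ r F₀} {d₀ = eval ℓ r G₀} (≢₁ ∘ proj₂)) (m≤m+n 1 _)
    ... | yes ≡₀ | yes ≡₁ = ≤-trans (begin
      fibre r                                     ≤⟨ sum-mono {b} (λ h → indicator-mono {value F₀ F₁ h r} {value G₀ G₁ h r} (λ _ → implies r (≡₀ , ≡₁))) ⟩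
      sum {b} (λ h → indicator (E ℓ F′ G′ r))     ≡⟨ sum-const b _ ⟩
      2 ^ b * indicator (E ℓ F′ G′ r)             ∎) (m≤n+m _ 1)

  combine : F₀ ≗ G₀ ⊎ count (E ℓ F₀ G₀) * 2 ^ b ≤ sum G₀ * Z →
            F₁ ≗ G₁ ⊎ count (E ℓ F₁ G₁) * 2 ^ b ≤ sum G₁ * Z →
            F ≗ G ⊎ count (E (suc ℓ) F G) * 2 ^ b ≤ sum G * 2 ^ (suc ℓ * b)
  combine (inj₁ ≗₀) (inj₁ ≗₁) = inj₁ λ { (false ∷ x) → ≗₀ x ; (true ∷ x) → ≗₁ x }
  combine (inj₁ ≗₀) (inj₂ bound₁) = inj₂ (constant-fibres F₁ G₁ implies bound₁ (m≤n+m (sum G₁) (sum G₀)))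
    where
    implies : ∀ h r → value F₀ F₁ h r ≡ value G₀ G₁ h r → eval ℓ r F₁ ≡ eval ℓ r G₁
    implies h r eq = *-cancelˡ-≡ _ _ (suc (fromBits h)) (+-cancelˡ-≡ (eval ℓ r F₀) _ _
      (trans eq (cong (_+ suc (fromBits h) * eval ℓ r G₁) (sym (eval-cong ℓ r ≗₀)))))
  combine (inj₂ bound₀) (inj₁ ≗₁) = inj₂ (constant-fibres F₀ G₀ implies bound₀ (m≤m+n (sum G₀) (sum G₁)))
    where
    implies : ∀ h r → value F₀ F₁ h r ≡ value G₀ G₁ h r → eval ℓ r F₀ ≡ eval ℓ r G₀
    implies h r eq = +-cancelʳ-≡ (suc (fromBits h) * eval ℓ r F₁) _ _
      (trans eq (cong (λ z → eval ℓ r G₀ + suc (fromBits h) * z) (sym (eval-cong ℓ r ≗₁))))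
  combine (inj₂ bound₀) (inj₂ bound₁) with sum G₀ ≟ 0 | sum G₁ ≟ 0
  -- The induction follows the half opposite to one of positive mass, and that mass pays the extra
  -- 1.
  ... | no G₀≢0  | _        = inj₂ (one-extra F₁ G₁ (λ _ → proj₂) bound₁ (+-monoˡ-≤ (sum G₁) (n≢0⇒n>0 G₀≢0)))
  ... | yes _    | no G₁≢0  = inj₂ (one-extra F₀ G₀ (λ _ → proj₁) bound₀
    (≤-trans (≤-reflexive (+-comm 1 (sum G₀))) (+-monoʳ-≤ (sum G₀) (n≢0⇒n>0 G₁≢0))))
  -- No mass is available here. But G evaluates to 0, and over ℕ nothing cancels, so a coincidence
  -- makes the coefficient from `F₀` vanish at r for every h.
  ... | yes G₀≡0 | yes G₁≡0 = inj₂ (constant-fibres F₀ G₀ implies bound₀ (m≤m+n (sum G₀) (sum G₁)))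
    where
    implies : ∀ h r → value F₀ F₁ h r ≡ value G₀ G₁ h r → eval ℓ r F₀ ≡ eval ℓ r G₀
    implies h r eq = trans (m+n≡0⇒m≡0 (eval ℓ r F₀) (trans eq G-vanishes)) (sym (vanish G₀ G₀≡0))
      where
      vanish : ∀ G → sum G ≡ 0 → eval ℓ r G ≡ 0
      vanish G G≡0 = n≤0⇒n≡0 (eval-≤ ℓ r (λ x → ≤-trans (≤-sum G x) (≤-reflexive G≡0)))
      G-vanishes : value G₀ G₁ h r ≡ 0
      G-vanishes = trans (cong₂ (λ u v → u + suc (fromBits h) * v) (vanish G₀ G₀≡0) (vanish G₁ G₁≡0))
        (*-zeroʳ (fromBits h))

-- Deterministic part: control and ledgers

lookup-ext : ∀ {A : Set} {n} {xs ys : Vec A n} → (∀ i → lookup xs i ≡ lookup ys i) → xs ≡ ys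
lookup-ext {xs = xs} {ys} eq =
  trans (sym (tabulate∘lookup xs)) (trans (tabulate-cong eq) (tabulate∘lookup ys))

lookup-∅ : ∀ {U} (u : Fin U) → lookup ∅ u ≡ 0
lookup-∅ u = lookup-replicate u 0

IsMin : ∀ {U} → Multiset U → Fin U → Set
IsMin M v = 0 < lookup M v × (∀ u → u Fin.< v → lookup M u ≡ 0)

min⇒IsMin : ∀ {U} {M : Multiset U} {v} → min M ≡ just v → IsMin M v
min⇒IsMin {M = zero ∷ M} eq with min M in eqM
min⇒IsMin {M = zero ∷ M} refl | just w with min⇒IsMin {M = M} eqM
... | 0<w , least = 0<w , λ { zero _ → refl ; (suc u) (s≤s u<w) → least u u<w }
min⇒IsMin {M = suc _ ∷ M} refl = s≤s z≤n , λ _ ()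

IsMin⇒min : ∀ {U} {M : Multiset U} {v} → IsMin M v → min M ≡ just v
IsMin⇒min {M = suc _ ∷ M} {zero}  _ = refl
IsMin⇒min {M = zero ∷ M}  {suc v} (0<v , least)
  rewrite IsMin⇒min {M = M} (0<v , λ u u<v → least (suc u) (s≤s u<v)) = refl
IsMin⇒min {M = suc _ ∷ M} {suc v} (_ , least) with () ← least zero (s≤s z≤n)

deleteMin≡ : ∀ {U} {M : Multiset U} {v} → min M ≡ just v → deleteMin M ≡ updateAt M v pred
deleteMin≡ eq rewrite eq = refl

-- xs lists the largest element extracted in each block, zero if there is none,
-- starting with the current block; blocks are numbered from 1, and 0 means never.
tag : ∀ {U} → List (Fin U) → Fin U → ℕ
tag []       u = 0
tag (x ∷ xs) u with u Fin.<? x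
... | yes _ = suc (length xs)
... | no  _ = tag xs u

-- A block without extractions pins zero, which costs no additional memory.
data Pinned {U : ℕ} : List (Fin U) → Fin U → Set where
  here  : ∀ {u xs} → Pinned (u ∷ xs) u
  there : ∀ {u x xs} → ¬ u Fin.< x → Pinned xs u → Pinned (x ∷ xs) u

pinned? : ∀ {U} (xs : List (Fin U)) u → Dec (Pinned xs u)
pinned? [] u = no λ ()
pinned? (x ∷ xs) u with u Fin.≟ x | u Fin.<? x | pinned? xs u
... | yes refl | _       | _     = yes here
... | no _     | no u≮x  | yes p = yes (there u≮x p)
... | no u≢x   | yes u<x | _     = no λ { here → u≢x refl ; (there u≮x _) → u≮x u<x }
... | no u≢x   | no _    | no ¬p = no λ { here → u≢x refl ; (there _ p) → ¬p p }

module _ {U : ℕ} where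

  tag-≤ : ∀ (xs : List (Fin U)) u → tag xs u ≤ length xs
  tag-≤ []       u = z≤n
  tag-≤ (x ∷ xs) u with u Fin.<? x
  ... | yes _ = ≤-refl
  ... | no  _ = m≤n⇒m≤1+n (tag-≤ xs u)

  tag-< : ∀ {x} {xs : List (Fin U)} {u} → u Fin.< x → tag (x ∷ xs) u ≡ suc (length xs)
  tag-< {x} {u = u} u<x with u Fin.<? x
  ... | yes _  = refl
  ... | no u≮x = contradiction u<x u≮x

  tag-≮ : ∀ {x} {xs : List (Fin U)} {u} → ¬ u Fin.< x → tag (x ∷ xs) u ≡ tag xs u
  tag-≮ {x} {u = u} u≮x with u Fin.<? x
  ... | yes u<x = contradiction u<x u≮x
  ... | no _    = refl

  tag-≤-older : ∀ {x} {xs : List (Fin U)} {u} → ¬ u Fin.< x → tag (x ∷ xs) u ≤ length xs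
  tag-≤-older {x} {xs} {u} u≮x = subst (_≤ length xs) (sym (tag-≮ {x} {xs} u≮x)) (tag-≤ xs u)

  -- The newest block has no maximum above a pinned u, so its number is not the tag. Extracting
  -- something larger therefore raises the tag strictly.
  pinned⇒tag< : ∀ {xs : List (Fin U)} {u} → Pinned xs u → tag xs u < length xs
  pinned⇒tag< {x ∷ xs} here          = s≤s (tag-≤-older (n≮n (toℕ x)))
  pinned⇒tag< {x ∷ xs} (there u≮x p) = s≤s (tag-≤-older u≮x)

  pinned⇒∈ : ∀ {xs : List (Fin U)} {u} → Pinned xs u → u ∈ xs
  pinned⇒∈ here        = here refl
  pinned⇒∈ (there _ p) = there (pinned⇒∈ p)

  raise : Fin U → Fin U → Fin U
  raise x v with x Fin.<? v
  ... | yes _ = v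
  ... | no  _ = x

  module _ {x v : Fin U} {xs : List (Fin U)} where

    tag-raise-< : ∀ {u} → u Fin.< v → tag (raise x v ∷ xs) u ≡ suc (length xs)
    tag-raise-< u<v with x Fin.<? v
    ... | yes _  = tag-< u<v
    ... | no x≮v = tag-< (<-≤-trans u<v (≮⇒≥ x≮v))

    tag-raise-≮ : ∀ {u} → ¬ u Fin.< v → tag (raise x v ∷ xs) u ≡ tag (x ∷ xs) u
    tag-raise-≮ u≮v with x Fin.<? v
    ... | yes x<v = trans (tag-≮ u≮v) (sym (tag-≮ (λ u<x → u≮v (<-trans u<x x<v))))
    ... | no _    = refl

    tag-raise-mono : ∀ u → tag (x ∷ xs) u ≤ tag (raise x v ∷ xs) u
    tag-raise-mono u with u Fin.<? v
    ... | yes u<v = subst (tag (x ∷ xs) u ≤_) (sym (tag-raise-< u<v)) (tag-≤ (x ∷ xs) u)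
    ... | no u≮v  = ≤-reflexive (sym (tag-raise-≮ u≮v))

    pinned-raise : ∀ {u} → ¬ u Fin.< v → Pinned (x ∷ xs) u → Pinned (raise x v ∷ xs) u
    pinned-raise u≮v p with x Fin.<? v
    ... | no _ = p
    pinned-raise u≮v here        | yes x<v = contradiction x<v u≮v
    pinned-raise u≮v (there _ p) | yes x<v = there u≮v p

    raise-≮ : ¬ v Fin.< x → raise x v ≡ v
    raise-≮ v≮x with x Fin.<? v
    ... | yes _  = refl
    ... | no x≮v = Fin.toℕ-injective (≤-antisym (≮⇒≥ v≮x) (≮⇒≥ x≮v))

    raise-dropped : x ≢ raise x v → x Fin.< v
    raise-dropped x≢ with x Fin.<? v
    ... | yes x<v = x<v
    ... | no _    = contradiction refl x≢

-- `recent` lists the elements of all symbols read in the current block. Its length signals the end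
-- of the block, and together with the maxima it covers the support of `exact`.
record Control (U : ℕ) : Set where
  constructor control
  field
    top    : Fin U
    older  : List (Fin U)
    recent : List (Fin U)
    exact  : Multiset U

  tops : List (Fin U)
  tops = top ∷ older

open Control

Ledger : ℕ → Set
Ledger U = Fin U → ℕ → ℕ

_⊕_ : ∀ {U} → Ledger U → Ledger U → Ledger U
(A ⊕ A′) u k = A u k + A′ u k

module _ {U : ℕ} (c : Control U) where

  -- If v is below the current maximum, its tag is the current block, for which nothing has been
  -- spilled yet; the extracted copy must then be explicit.
  Admissible : Fin U → Set
  Admissible v = (∀ u → u Fin.< v → lookup (exact c) u ≡ 0) × (v Fin.< top c → 0 < lookup (exact c) v)

  admissible? : ∀ v → Dec (Admissible v)
  admissible? v = Fin.all? (λ u → (u Fin.<? v) →-dec (lookup (exact c) u ≟ 0)) ×-dec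
                  ((v Fin.<? top c) →-dec (0 <? lookup (exact c) v))

  extract : Fin U → Control U
  extract v = control (raise (top c) v) (older c) (v ∷ recent c) (updateAt (exact c) v pred)

  add : Fin U → Control U
  add u = control (top c) (older c) (u ∷ recent c) (insert u (exact c))

  read : Symbol U → Maybe (Control U)
  read (ins u) = just (add u)
  read (ext v) with admissible? v
  ... | yes _ = just (extract v)
  ... | no  _ = nothing

  Charged : Fin U → Fin U → ℕ → Set
  Charged v u k = u ≡ v × k ≡ tag (tops c) v × lookup (exact c) v ≡ 0

  charged? : ∀ v u k → Dec (Charged v u k)
  charged? v u k = (u Fin.≟ v) ×-dec (k ≟ tag (tops c) v) ×-dec (lookup (exact c) v ≟ 0)

  charge : Symbol U → Ledger U
  charge (ins _) u k = 0
  charge (ext v) u k = indicator (does (charged? v u k))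

  charge-hit : ∀ v u k → Charged v u k → charge (ext v) u k ≡ 1
  charge-hit v u k p = cong indicator (dec-true (charged? v u k) p)

  charge-miss : ∀ v u k → ¬ Charged v u k → charge (ext v) u k ≡ 0
  charge-miss v u k ¬p = cong indicator (dec-false (charged? v u k) ¬p)

  Spilled : Fin U → ℕ → Set
  Spilled u k = k ≡ tag (tops c) u × ¬ Pinned (tops c) u

  spilled? : ∀ u k → Dec (Spilled u k)
  spilled? u k = (k ≟ tag (tops c) u) ×-dec ¬? (pinned? (tops c) u)

  spill : Ledger U
  spill u k = if does (spilled? u k) then lookup (exact c) u else 0

  spill-hit : ∀ u k → Spilled u k → spill u k ≡ lookup (exact c) u
  spill-hit u k p = cong (if_then lookup (exact c) u else 0) (dec-true (spilled? u k) p)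

  spill-miss : ∀ u k → ¬ Spilled u k → spill u k ≡ 0
  spill-miss u k ¬p = cong (if_then lookup (exact c) u else 0) (dec-false (spilled? u k) ¬p)

  kept : Fin U → ℕ
  kept u = if does (pinned? (tops c) u) then lookup (exact c) u else 0

  kept-pinned : ∀ {u} → Pinned (tops c) u → kept u ≡ lookup (exact c) u
  kept-pinned {u} p = cong (if_then lookup (exact c) u else 0) (dec-true (pinned? (tops c) u) p)

  kept-unpinned : ∀ {u} → ¬ Pinned (tops c) u → kept u ≡ 0
  kept-unpinned {u} ¬p = cong (if_then lookup (exact c) u else 0) (dec-false (pinned? (tops c) u) ¬p)

close : ∀ {n} → Control (suc n) → Control (suc n)
close c = control zero (tops c) [] (tabulate (kept c))

-- H is Ledger in the analysis and ℕ, holding fingerprints, in the algorithm.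
record State (U : ℕ) (H : Set) : Set where
  constructor state
  field
    ctrl    : Control U
    spilled : H
    charged : H

open State

module _ {n : ℕ} (B : ℕ) {H : Set} (_+ᴴ_ : H → Ledger (suc n) → H) where

  settle : State (suc n) H → State (suc n) H
  settle (state c a x) with length (recent c) ≟ B
  ... | yes _ = state (close c) (a +ᴴ spill c) x
  ... | no  _ = state c a x

  advance : State (suc n) H → Symbol (suc n) → Maybe (State (suc n) H)
  advance (state c a x) s with read c s
  ... | just c′ = just (settle (state c′ a (x +ᴴ charge c s)))
  ... | nothing = nothing

  process : ∀ {N} → State (suc n) H → Vec (Symbol (suc n)) N → Maybe (State (suc n) H)
  process s []      = just s
  process s (y ∷ σ) = advance s y >>= λ s′ → process s′ σ

-- Invariants linking the multiset to the ledgers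

module _ {U : ℕ} (M : Multiset U) (s : State U (Ledger U)) where

  record Consistent : Set where
    private c = ctrl s
    field
      balance : ∀ u → lookup M u + charged s u (tag (tops c) u) ≡
                      lookup (exact c) u + spilled s u (tag (tops c) u)
      solvent : ∀ u → charged s u (tag (tops c) u) ≤ spilled s u (tag (tops c) u)
      fresh   : ∀ u k → length (tops c) ≤ k → spilled s u k ≡ 0 × charged s u k ≡ 0

open Consistent

-- A former tag of u was left when no copy of u remained, which closes its account. At the end this
-- leaves only the current tags to `balance`.
Settled : ∀ {U} → State U (Ledger U) → Set
Settled s = ∀ u k → k ≢ tag (tops (ctrl s)) u → spilled s u k ≡ charged s u k

module _ {U} {M : Multiset U} {c : Control U} {A X : Ledger U} where

  private
    e = lookup (exact c)
    t = tag (tops c)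

  ins-consistent : ∀ u → Consistent M (state c A X) →
    Consistent (insert u M) (state (add c u) A (X ⊕ charge c (ins u)))
  balance (ins-consistent u inv) w with u Fin.≟ w
  ... | yes refl rewrite lookup∘updateAt u {f = suc} M | lookup∘updateAt u {f = suc} (exact c)
                       | +-identityʳ (X u (t u)) = cong suc (balance inv u)
  ... | no u≢w   rewrite lookup∘updateAt′ w u {f = suc} (u≢w ∘ sym) M
                       | lookup∘updateAt′ w u {f = suc} (u≢w ∘ sym) (exact c)
                       | +-identityʳ (X w (t w)) = balance inv w
  solvent (ins-consistent u inv) w = subst (_≤ A w (t w)) (sym (+-identityʳ _)) (solvent inv w)
  fresh (ins-consistent u inv) w k L≤k = proj₁ (fresh inv w k L≤k) , trans (+-identityʳ _) (proj₂ (fresh inv w k L≤k))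

  charge-other : ∀ {u v} → u ≢ v → ∀ k → (X ⊕ charge c (ext v)) u k ≡ X u k
  charge-other {u} u≢v k = trans (cong (X u k +_) (charge-miss c _ _ k (u≢v ∘ proj₁))) (+-identityʳ _)

  -- With no explicit copy of v, `balance` and a positive multiplicity give strictly more spills
  -- than charges, so there is room for one more charge.
  paid : ∀ {v} → Consistent M (state c A X) → 0 < lookup M v → let X′ = X ⊕ charge c (ext v) in
    pred (lookup M v) + X′ v (t v) ≡ pred (e v) + A v (t v) × X′ v (t v) ≤ A v (t v)
  paid {v} inv 0<M = pay (balance inv v) (solvent inv v) 0<M
    (λ e≡0 → charge-hit c v v (t v) (refl , refl , e≡0)) (λ e≢0 → charge-miss c v v (t v) (e≢0 ∘ proj₂ ∘ proj₂))
    where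
    pay : ∀ {m x e a y} → m + x ≡ e + a → x ≤ a → 0 < m → (e ≡ 0 → y ≡ 1) → (e ≢ 0 → y ≡ 0) →
          pred m + (x + y) ≡ pred e + a × x + y ≤ a
    pay {suc m} {x} {zero} {a} refl x≤a _ y≡1 _ rewrite y≡1 refl | +-comm x 1 = +-suc m x , s≤s (m≤n+m x m)
    pay {suc m} {x} {suc e} bal x≤a _ _ y≡0 rewrite y≡0 (λ ()) | +-identityʳ x = suc-injective bal , x≤a

  -- Below v the tag jumps to the current block, where both ledgers are empty by `fresh`, and both
  -- multiplicities are 0. Above v nothing changes, and v itself is handled by `paid`.
  ext-consistent : ∀ {v} → IsMin M v → Admissible c v → Consistent M (state c A X) →
    Consistent (updateAt M v pred) (state (extract c v) A (X ⊕ charge c (ext v)))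
  balance (ext-consistent {v} (0<v , least) (below , _) inv) u with Fin.<-cmp u v
  ... | tri< u<v u≢v _
      rewrite tag-raise-< {x = top c} {xs = older c} u<v | charge-other u≢v (suc (length (older c)))
            | lookup∘updateAt′ u v {f = pred} u≢v M | lookup∘updateAt′ u v {f = pred} u≢v (exact c)
            | least u u<v | below u u<v
            | proj₁ (fresh inv u _ ≤-refl) | proj₂ (fresh inv u _ ≤-refl) = refl
  ... | tri> u≮v u≢v _
      rewrite tag-raise-≮ {x = top c} {xs = older c} u≮v | charge-other u≢v (t u)
            | lookup∘updateAt′ u v {f = pred} u≢v M | lookup∘updateAt′ u v {f = pred} u≢v (exact c) = balance inv u
  ... | tri≈ u≮v refl _
      rewrite tag-raise-≮ {x = top c} {xs = older c} u≮v
            | lookup∘updateAt u {f = pred} M | lookup∘updateAt u {f = pred} (exact c) = proj₁ (paid inv 0<v)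
  solvent (ext-consistent {v} (0<v , least) (below , _) inv) u with Fin.<-cmp u v
  ... | tri< u<v u≢v _
      rewrite tag-raise-< {x = top c} {xs = older c} u<v | charge-other u≢v (suc (length (older c)))
            | proj₂ (fresh inv u _ ≤-refl) = z≤n
  ... | tri> u≮v u≢v _
      rewrite tag-raise-≮ {x = top c} {xs = older c} u≮v | charge-other u≢v (t u) = solvent inv u
  ... | tri≈ u≮v refl _
      rewrite tag-raise-≮ {x = top c} {xs = older c} u≮v = proj₂ (paid inv 0<v)
  fresh (ext-consistent {v} _ (_ , guard) inv) u k L≤k =
    proj₁ (fresh inv u k L≤k) , cong₂ _+_ (proj₂ (fresh inv u k L≤k)) (charge-miss c v u k uncharged)
    where
    -- A charge under the current block number would put v below the block maximum, where
    -- admissibility guarantees an explicit copy to use instead.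
    uncharged : ¬ Charged c v u k
    uncharged (refl , refl , e≡0) =
      <⇒≱ L≤k (tag-≤-older (λ v<top → <⇒≢ (guard v<top) (sym e≡0)))

  ext-settled : ∀ {v} → IsMin M v → Admissible c v → Consistent M (state c A X) → Settled (state c A X) →
    Settled (state (extract c v) A (X ⊕ charge c (ext v)))
  ext-settled {v} (_ , least) (below , _) inv set u k k≢t with Fin.<-cmp u v
  ... | tri> u≮v u≢v _ rewrite charge-other u≢v k =
    set u k (k≢t ∘ λ eq → trans eq (sym (tag-raise-≮ {x = top c} {xs = older c} u≮v)))
  ... | tri≈ u≮v refl _ =
    trans (set u k k≢t′) (sym (trans (cong (X u k +_) (charge-miss c u u k (k≢t′ ∘ proj₁ ∘ proj₂))) (+-identityʳ _)))
    where k≢t′ = k≢t ∘ λ eq → trans eq (sym (tag-raise-≮ {x = top c} {xs = older c} u≮v))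
  ... | tri< u<v u≢v _ rewrite charge-other u≢v k with k ≟ t u
  ...   | no k≢t′  = set u k k≢t′
  -- This is the tag just abandoned: with no copy in M and none explicit, `balance` becomes the
  -- equality of the ledgers.
  ...   | yes refl = sym (subst₂ (λ m z → m + X u (t u) ≡ z + A u (t u)) (least u u<v) (below u u<v) (balance inv u))

  -- Below the minimum M vanishes, so `balance` and `solvent` leave no explicit copies. If v is
  -- below the block maximum, `fresh` empties its entry and all its copies are explicit.
  admissible : ∀ {v} → IsMin M v → Consistent M (state c A X) → Admissible c v
  admissible {v} (0<v , least) inv = below , guard
    where
    below : ∀ u → u Fin.< v → e u ≡ 0
    below u u<v = n≤0⇒n≡0 (+-cancelʳ-≤ (A u (t u)) (e u) 0
      (≤-trans (≤-reflexive (sym (trans (cong (_+ X u (t u)) (sym (least u u<v))) (balance inv u)))) (solvent inv u)))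
    guard : v Fin.< top c → 0 < e v
    guard v<top = subst (0 <_) (+-cancelʳ-≡ 0 _ _
      (subst (λ (a , x) → lookup M v + x ≡ e v + a) fresh′ (balance inv v))) 0<v
      where
      fresh′ : (A v (t v) , X v (t v)) ≡ (0 , 0)
      fresh′ with fresh inv v (t v) (≤-reflexive (sym (tag-< {xs = older c} v<top)))
      ... | a≡0 , x≡0 = cong₂ _,_ a≡0 x≡0

module _ {n} {c : Control (suc n)} {A X : Ledger (suc n)} where

  close-consistent : ∀ {M} → Consistent M (state c A X) → Consistent M (state (close c) (A ⊕ spill c) X)
  balance (close-consistent inv) u rewrite lookup∘tabulate (kept c) u = trans (balance inv u) (transfer (pinned? (tops c) u))
    where
    t = tag (tops c) u
    a = A u t
    transfer : Dec (Pinned (tops c) u) → lookup (exact c) u + a ≡ kept c u + (a + spill c u t)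
    transfer (yes p) = sym (cong₂ _+_ (kept-pinned c p) (trans (cong (a +_) (spill-miss c u t (λ s → proj₂ s p))) (+-identityʳ a)))
    transfer (no ¬p) = sym (trans (cong₂ _+_ (kept-unpinned c ¬p) (cong (a +_) (spill-hit c u t (refl , ¬p)))) (+-comm a _))
  solvent (close-consistent inv) u = ≤-trans (solvent inv u) (m≤m+n _ _)
  fresh (close-consistent inv) u k L<k with fresh inv u k (<⇒≤ L<k)
  ... | a≡0 , x≡0 = cong₂ _+_ a≡0 (spill-miss c u k (λ { (refl , _) → <⇒≱ L<k (tag-≤ (tops c) u) })) , x≡0

  close-settled : Settled (state c A X) → Settled (state (close c) (A ⊕ spill c) X)
  close-settled set u k k≢t = trans (cong (A u k +_) (spill-miss c u k (k≢t ∘ proj₁))) (trans (+-identityʳ _) (set u k k≢t))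

-- Nothing more will be spilled into the entry (u , k).
Frozen : ∀ {U} → Control U → Fin U → ℕ → Set
Frozen c u k = (k ≡ tag (tops c) u × Pinned (tops c) u) ⊎ k < tag (tops c) u

-- These facts hold along every surviving run, whether or not its extractions are correct, so they
-- may be used before correctness is known.
record _⊑_ {U} (s s′ : State U (Ledger U)) : Set where
  field
    later         : ∀ u k → k < tag (tops (ctrl s)) u → k < tag (tops (ctrl s′)) u
    stays-frozen  : ∀ u k → Frozen (ctrl s) u k → Frozen (ctrl s′) u k
    spilled-final : ∀ u k → Frozen (ctrl s) u k → spilled s′ u k ≡ spilled s u k
    charged-final : ∀ u k → k < tag (tops (ctrl s)) u → charged s′ u k ≡ charged s u k
    charged-mono  : ∀ u k → charged s u k ≤ charged s′ u k

open _⊑_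

⊑-refl : ∀ {U} {s : State U (Ledger U)} → s ⊑ s
⊑-refl = record
  { later = λ _ _ p → p ; stays-frozen = λ _ _ p → p ; spilled-final = λ _ _ _ → refl
  ; charged-final = λ _ _ _ → refl ; charged-mono = λ _ _ → ≤-refl }

⊑-trans : ∀ {U} {s₁ s₂ s₃ : State U (Ledger U)} → s₁ ⊑ s₂ → s₂ ⊑ s₃ → s₁ ⊑ s₃
⊑-trans p q = record
  { later         = λ u k l → later q u k (later p u k l)
  ; stays-frozen  = λ u k f → stays-frozen q u k (stays-frozen p u k f)
  ; spilled-final = λ u k f → trans (spilled-final q u k (stays-frozen p u k f)) (spilled-final p u k f)
  ; charged-final = λ u k l → trans (charged-final q u k (later p u k l)) (charged-final p u k l)
  ; charged-mono  = λ u k → ≤-trans (charged-mono p u k) (charged-mono q u k) }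

module _ {U} {c : Control U} {A X : Ledger U} where

  ins-⊑ : ∀ u → state c A X ⊑ state (add c u) A (X ⊕ charge c (ins u))
  ins-⊑ u = record
    { later = λ _ _ p → p ; stays-frozen = λ _ _ p → p ; spilled-final = λ _ _ _ → refl
    ; charged-final = λ _ _ _ → +-identityʳ _ ; charged-mono = λ _ _ → m≤m+n _ _ }

  ext-⊑ : ∀ v → state c A X ⊑ state (extract c v) A (X ⊕ charge c (ext v))
  ext-⊑ v = record
    { later = later′ ; stays-frozen = stays ; spilled-final = λ _ _ _ → refl
    ; charged-final = λ u k k<t → trans (cong (X u k +_) (charge-miss c v u k
        (λ { (refl , refl , _) → <-irrefl refl k<t }))) (+-identityʳ _)
    ; charged-mono = λ _ _ → m≤m+n _ _ }
    where
    later′ : ∀ u k → k < tag (tops c) u → k < tag (raise (top c) v ∷ older c) u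
    later′ u k k<t = <-≤-trans k<t (tag-raise-mono {x = top c} {v} {older c} u)
    stays : ∀ u k → Frozen c u k → Frozen (extract c v) u k
    stays u k (inj₂ k<t) = inj₂ (later′ u k k<t)
    stays u k (inj₁ (refl , p)) with u Fin.<? v
    ... | no u≮v  = inj₁ (sym (tag-raise-≮ {x = top c} {xs = older c} u≮v) , pinned-raise u≮v p)
    -- Extracting something larger unpins u, but at the same time lifts its tag past k.
    ... | yes u<v = inj₂ (subst (tag (tops c) u <_) (sym (tag-raise-< {x = top c} {xs = older c} u<v)) (pinned⇒tag< p))

close-⊑ : ∀ {n} {c : Control (suc n)} {A X : Ledger (suc n)} → state c A X ⊑ state (close c) (A ⊕ spill c) X
close-⊑ {c = c} {A} = record
  { later = λ _ _ p → p ; stays-frozen = stays ; spilled-final = unspilled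
  ; charged-final = λ _ _ _ → refl ; charged-mono = λ _ _ → ≤-refl }
  where
  stays : ∀ u k → Frozen c u k → Frozen (close c) u k
  -- A new block starts with maximum zero; nothing is below zero, so pins survive.
  stays u k (inj₁ (eq , p)) = inj₁ (eq , there (λ ()) p)
  stays u k (inj₂ k<t)      = inj₂ k<t
  unspilled : ∀ u k → Frozen c u k → (A ⊕ spill c) u k ≡ A u k
  unspilled u k f = trans (cong (A u k +_) (spill-miss c u k (not-spilled f))) (+-identityʳ _)
    where
    not-spilled : Frozen c u k → ¬ Spilled c u k
    not-spilled (inj₁ (_ , p)) (_ , ¬p)   = ¬p p
    not-spilled (inj₂ k<t)     (refl , _) = <-irrefl refl k<t

-- Soundness and completeness with exact ledgers

Valid : ∀ {U N} → Multiset U → Vec (Symbol U) N → Set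
Valid M []          = M ≡ ∅
Valid M (ins u ∷ σ) = Valid (insert u M) σ
Valid M (ext v ∷ σ) = min M ≡ just v × Valid (deleteMin M) σ

-- In a consistent state both ledgers are empty above the tag, so that keys with
-- larger k need not be represented.
Agreeing : ∀ {U} → State U (Ledger U) → Set
Agreeing s = ∀ u k → k ≤ tag (tops (ctrl s)) u → spilled s u k ≡ charged s u k

Balanced : ∀ {U} → State U (Ledger U) → Set
Balanced s = (∀ u k → spilled s u k ≡ charged s u k) × exact (ctrl s) ≡ ∅

module _ {n : ℕ} (B : ℕ) where

  private
    Ghost = State (suc n) (Ledger (suc n))

    settle⁺ : Ghost → Ghost
    settle⁺ = settle B _⊕_

    advance⁺ : Ghost → Symbol (suc n) → Maybe Ghost
    advance⁺ = advance B _⊕_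

    process⁺ : ∀ {N} → Ghost → Vec (Symbol (suc n)) N → Maybe Ghost
    process⁺ = process B _⊕_

  settle-consistent : ∀ {M s} → Consistent M s → Consistent M (settle⁺ s)
  settle-consistent {s = state c _ _} inv with length (recent c) ≟ B
  ... | yes _ = close-consistent inv
  ... | no _  = inv

  settle-settled : ∀ {s} → Settled s → Settled (settle⁺ s)
  settle-settled {state c _ _} set with length (recent c) ≟ B
  ... | yes _ = close-settled {c = c} set
  ... | no _  = set

  settle-⊑ : ∀ {s} → s ⊑ settle⁺ s
  settle-⊑ {state c _ _} with length (recent c) ≟ B
  ... | yes _ = close-⊑
  ... | no _  = ⊑-refl

  advance-⊑ : ∀ {s y s′} → advance⁺ s y ≡ just s′ → s ⊑ s′
  advance-⊑ {state c _ _} {ins u} refl = ⊑-trans (ins-⊑ u) settle-⊑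
  advance-⊑ {state c _ _} {ext v} eq with admissible? c v
  advance-⊑ {state c _ _} {ext v} refl | yes _ = ⊑-trans (ext-⊑ v) settle-⊑

  process-⊑ : ∀ {N s s′} (σ : Vec (Symbol (suc n)) N) → process⁺ s σ ≡ just s′ → s ⊑ s′
  process-⊑ []      refl = ⊑-refl
  process-⊑ {s = s} (y ∷ σ) eq with advance⁺ s y in eqs
  ... | just s′ = ⊑-trans (advance-⊑ {s} {y} eqs) (process-⊑ σ eq)

  consistent⇒empty : ∀ {M} {s : Ghost} → Consistent M s → Agreeing s → exact (ctrl s) ≡ ∅ → M ≡ ∅
  consistent⇒empty {M} {s} inv same e≡∅ = lookup-ext λ u → trans
    (+-cancelʳ-≡ _ (lookup M u) (lookup (exact (ctrl s)) u)
      (trans (balance inv u) (cong (lookup (exact (ctrl s)) u +_) (same u _ ≤-refl))))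
    (cong (λ E → lookup E u) e≡∅)

  module _ {M : Multiset (suc n)} {c A X s⋆} {v : Fin (suc n)} (inv : Consistent M (state c A X))
           (adm : Admissible c v) (future : state (extract c v) A (X ⊕ charge c (ext v)) ⊑ s⋆)
           (same : Agreeing s⋆) where

    private
      e = lookup (exact c)
      t = tag (tops c)

    -- A final equality of the ledgers is already present in every entry that
    -- can no longer change; v has just been pinned, and the tags below v have
    -- just been abandoned.
    extraction-correct : IsMin M v
    extraction-correct = present , least
      where
      least : ∀ u → u Fin.< v → lookup M u ≡ 0
      least u u<v = +-cancelʳ-≡ (X u (t u)) (lookup M u) 0 (trans (balance inv u)
        (trans (cong (_+ A u (t u)) (proj₁ adm u u<v)) (A≡X (m≤n⇒m<n∨m≡n (tag-≤ (tops c) u)))))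
        where
        A≡X : t u < length (tops c) ⊎ t u ≡ length (tops c) → A u (t u) ≡ X u (t u)
        A≡X (inj₂ t≡L) with fresh inv u (t u) (≤-reflexive (sym t≡L))
        ... | a≡0 , x≡0 = trans a≡0 (sym x≡0)
        A≡X (inj₁ t<L) = begin
          A u (t u)                          ≡⟨ spilled-final future u (t u) (inj₂ t<t′) ⟨
          spilled s⋆ u (t u)                 ≡⟨ same u (t u) (<⇒≤ (later future u (t u) t<t′)) ⟩
          charged s⋆ u (t u)                 ≡⟨ charged-final future u (t u) t<t′ ⟩
          X u (t u) + charge c (ext v) u (t u)
            ≡⟨ charge-other {M = M} {c} {A} {X} (λ { refl → n≮n _ u<v }) (t u) ⟩
          X u (t u)                          ∎
          where
          open ≡-Reasoning
          t<t′ : t u < tag (raise (top c) v ∷ older c) u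
          t<t′ = subst (t u <_) (sym (tag-raise-< {x = top c} {xs = older c} u<v)) t<L

      positive : ∀ {m x e a} → m + x ≡ e + a → x ≤ a → 0 < e ⊎ x < a → 0 < m
      positive {suc m}     _    _   _         = s≤s z≤n
      positive {zero} {e = suc e} refl x≤a _  = contradiction x≤a (<⇒≱ (s≤s (m≤n+m _ e)))
      positive {zero} {e = zero}  refl _   (inj₂ x<a) = contradiction x<a (n≮n _)

      present : 0 < lookup M v
      present = positive (balance inv v) (solvent inv v) source
        where
        source : 0 < e v ⊎ X v (t v) < A v (t v)
        source with e v ≟ 0
        ... | no e≢0  = inj₁ (n≢0⇒n>0 e≢0)
        ... | yes e≡0 = inj₂ (begin
          suc (X v (t v))                         ≡⟨ +-comm 1 _ ⟩
          X v (t v) + 1                           ≡⟨ cong (X v (t v) +_) (charge-hit c v v (t v) (refl , refl , e≡0)) ⟨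
          X v (t v) + charge c (ext v) v (t v)    ≤⟨ charged-mono future v (t v) ⟩
          charged s⋆ v (t v)                      ≡⟨ same v (t v) (frozen⇒≤ {ctrl s⋆} (stays-frozen future v (t v) frozen)) ⟨
          spilled s⋆ v (t v)                      ≡⟨ spilled-final future v (t v) frozen ⟩
          A v (t v)                               ∎)
          where
          open ≤-Reasoning
          frozen⇒≤ : ∀ {c u k} → Frozen c u k → k ≤ tag (tops c) u
          frozen⇒≤ (inj₁ (refl , _)) = ≤-refl
          frozen⇒≤ (inj₂ k<t)        = <⇒≤ k<t
          -- Without an explicit copy, admissibility excludes v below the block maximum, so v
          -- becomes that maximum and is pinned: the charge just made must be covered by spills
          -- already entered.
          v≮top : ¬ v Fin.< top c
          v≮top v<top = <⇒≢ (proj₂ adm v<top) (sym e≡0)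
          frozen : Frozen (extract c v) v (t v)
          frozen = inj₁ (sym (tag-raise-≮ {x = top c} {xs = older c} (n≮n _))
                        , subst (λ x → Pinned (x ∷ older c) v) (sym (raise-≮ {xs = older c} v≮top)) here)

  -- Consistency of the next state needs the present extraction to be correct, and this is deduced
  -- from the final state through `process-⊑`. The induction thus runs forward while every step
  -- looks ahead to the same end.
  sound : ∀ {N M s s⋆} (σ : Vec (Symbol (suc n)) N) → Consistent M s → process⁺ s σ ≡ just s⋆ →
          Agreeing s⋆ → exact (ctrl s⋆) ≡ ∅ → Valid M σ
  sound {s = s} [] inv refl same e≡∅ = consistent⇒empty {_} {s} inv same e≡∅
  sound {s = state c A X} (ins u ∷ σ) inv eq same e≡∅ =
    sound σ (settle-consistent {s = state (add c u) A (X ⊕ charge c (ins u))} (ins-consistent u inv)) eq same e≡∅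
  sound {M = M} {state c A X} (ext v ∷ σ) inv eq same e≡∅ with admissible? c v
  ... | yes adm = IsMin⇒min {M = M} isMin , subst (λ M → Valid M σ) (sym (deleteMin≡ {M = M} (IsMin⇒min {M = M} isMin)))
          (sound σ (settle-consistent {s = after} (ext-consistent isMin adm inv)) eq same e≡∅)
    where
    after = state (extract c v) A (X ⊕ charge c (ext v))
    isMin : IsMin M v
    isMin = extraction-correct {M = M} inv adm (⊑-trans (settle-⊑ {after}) (process-⊑ σ eq)) same

  settled⇒balanced : ∀ {s : Ghost} → Consistent ∅ s → Settled s → Balanced s
  settled⇒balanced {s} inv set = same , e≡∅
    where
    c = ctrl s
    t = tag (tops c)
    e≡0 : ∀ u → lookup (exact c) u ≡ 0
    e≡0 u = n≤0⇒n≡0 (+-cancelʳ-≤ (spilled s u (t u)) _ 0 (≤-trans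
      (≤-reflexive (trans (sym (balance inv u)) (cong (_+ charged s u (t u)) (lookup-∅ u)))) (solvent inv u)))
    e≡∅ : exact c ≡ ∅
    e≡∅ = lookup-ext λ u → trans (e≡0 u) (sym (lookup-∅ u))
    same : ∀ u k → spilled s u k ≡ charged s u k
    same u k with k ≟ t u
    ... | no k≢t   = set u k k≢t
    ... | yes refl = sym (subst₂ (λ m z → m + charged s u (t u) ≡ z + spilled s u (t u)) (lookup-∅ u) (e≡0 u) (balance inv u))

  complete : ∀ {N M s} (σ : Vec (Symbol (suc n)) N) → Consistent M s → Settled s → Valid M σ →
             ∃ λ s⋆ → process⁺ s σ ≡ just s⋆ × Balanced s⋆
  complete {s = s} [] inv set refl = s , refl , settled⇒balanced {s} inv set
  complete {s = state c A X} (ins u ∷ σ) inv set valid =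
    complete σ (settle-consistent {s = after} (ins-consistent u inv))
      (settle-settled {after} λ u k k≢t → trans (set u k k≢t) (sym (+-identityʳ _))) valid
    where after = state (add c u) A (X ⊕ charge c (ins u))
  complete {M = M} {s = state c A X} (ext v ∷ σ) inv set (min≡v , valid) with admissible? c v
  ... | no ¬adm = contradiction (admissible {M = M} isMin inv) ¬adm
    where isMin = min⇒IsMin {M = M} min≡v
  ... | yes adm = complete σ
          (settle-consistent {s = after} (subst (λ M → Consistent M after) (sym (deleteMin≡ {M = M} min≡v)) (ext-consistent {M = M} isMin adm inv)))
          (settle-settled {after} (ext-settled {M = M} isMin adm inv set)) valid
    where
    after = state (extract c v) A (X ⊕ charge c (ext v))
    isMin = min⇒IsMin {M = M} min≡v

contentsFrom : ∀ {U N} → Multiset U → Vec (Symbol U) N → ℕ → Multiset U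
contentsFrom M σ j = List.foldl update M (List.take j (toList σ))

PQFrom : ∀ {U N} → Multiset U → Vec (Symbol U) N → Set
PQFrom {U} {N} M σ =
  contentsFrom M σ N ≡ ∅ ×
  (∀ (j : Fin N) (u : Fin U) → lookup σ j ≡ ext u → min (contentsFrom M σ (toℕ j)) ≡ just u)

Valid⇒PQFrom : ∀ {U N M} (σ : Vec (Symbol U) N) → Valid M σ → PQFrom M σ
Valid⇒PQFrom [] valid = valid , λ ()
Valid⇒PQFrom (ins u ∷ σ) valid with Valid⇒PQFrom σ valid
... | end , mins = end , λ { zero _ () ; (suc j) → mins j }
Valid⇒PQFrom (ext v ∷ σ) (min≡v , valid) with Valid⇒PQFrom σ valid
... | end , mins = end , λ { zero _ refl → min≡v ; (suc j) → mins j }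

PQFrom⇒Valid : ∀ {U N M} (σ : Vec (Symbol U) N) → PQFrom M σ → Valid M σ
PQFrom⇒Valid []          (end , _)    = end
PQFrom⇒Valid (ins u ∷ σ) (end , mins) = PQFrom⇒Valid σ (end , mins ∘ suc)
PQFrom⇒Valid (ext v ∷ σ) (end , mins) = mins zero v refl , PQFrom⇒Valid σ (end , mins ∘ suc)

-- Size bounds along the run

record Bounded {U} (B t : ℕ) (s : State U (Ledger U)) : Set where
  private c = ctrl s
  field
    -- The sum is bounded, not each term, because closing a block moves copies from `exact` to the
    -- ledger.
    holdings : ∀ u k → spilled s u k + lookup (exact c) u ≤ t
    charges  : ∀ u k → charged s u k ≤ t
    position : length (older c) * B + length (recent c) ≡ t
    support  : ∀ u → u ∉ tops c → u ∉ recent c → lookup (exact c) u ≡ 0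

open Bounded

charge-≤1 : ∀ {U} (c : Control U) y u k → charge c y u k ≤ 1
charge-≤1 c (ins _) u k = z≤n
charge-≤1 c (ext v) u k = indicator-≤1 (does (charged? c v u k))

module _ {U B t : ℕ} {c : Control U} {A X : Ledger U} (bd : Bounded B t (state c A X)) where

  private
    charges′ : ∀ y u k → (X ⊕ charge c y) u k ≤ suc t
    charges′ y u k = subst ((X ⊕ charge c y) u k ≤_) (+-comm t 1) (+-mono-≤ (charges bd u k) (charge-≤1 c y u k))

    position′ : length (older c) * B + suc (length (recent c)) ≡ suc t
    position′ = trans (+-suc _ _) (cong suc (position bd))

  add-bounded : ∀ u → Bounded B (suc t) (state (add c u) A (X ⊕ charge c (ins u)))
  holdings (add-bounded u) w k with u Fin.≟ w
  ... | yes refl rewrite lookup∘updateAt u {f = suc} (exact c) | +-suc (A u k) (lookup (exact c) u) = s≤s (holdings bd u k)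
  ... | no u≢w   rewrite lookup∘updateAt′ w u {f = suc} (u≢w ∘ sym) (exact c) = m≤n⇒m≤1+n (holdings bd w k)
  charges (add-bounded u) = charges′ (ins u)
  position (add-bounded u) = position′
  support (add-bounded u) w w∉tops w∉recent =
    trans (lookup∘updateAt′ w u (w∉recent ∘ here) (exact c)) (support bd w w∉tops (w∉recent ∘ there))

  extract-bounded : ∀ {v} → Admissible c v → Bounded B (suc t) (state (extract c v) A (X ⊕ charge c (ext v)))
  holdings (extract-bounded {v} _) u k with v Fin.≟ u
  ... | yes refl rewrite lookup∘updateAt v {f = pred} (exact c) =
    m≤n⇒m≤1+n (≤-trans (+-monoʳ-≤ (A v k) pred[n]≤n) (holdings bd v k))
  ... | no v≢u   rewrite lookup∘updateAt′ u v {f = pred} (v≢u ∘ sym) (exact c) = m≤n⇒m≤1+n (holdings bd u k)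
  charges (extract-bounded {v} _) = charges′ (ext v)
  position (extract-bounded _) = position′
  support (extract-bounded {v} (below , _)) u u∉tops u∉recent =
    trans (lookup∘updateAt′ u v (u∉recent ∘ here) (exact c)) e≡0
    where
    e≡0 : lookup (exact c) u ≡ 0
    e≡0 with u Fin.≟ top c
    ... | no u≢top = support bd u (λ { (here eq) → u≢top eq ; (there u∈) → u∉tops (there u∈) }) (u∉recent ∘ there)
    -- The replaced maximum drops out of the lists; being below v, it has no explicit copies by
    -- admissibility.
    ... | yes refl = below u (raise-dropped {xs = older c} (u∉tops ∘ here))

close-bounded : ∀ {n B t} {c : Control (suc n)} {A X} → length (recent c) ≡ B →
  Bounded B t (state c A X) → Bounded B t (state (close c) (A ⊕ spill c) X)
holdings (close-bounded {t = t} {c} {A} _ bd) u k rewrite lookup∘tabulate (kept c) u =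
  ≤-trans (≤-reflexive (+-assoc (A u k) _ _))
    (≤-trans (+-monoʳ-≤ (A u k) (moved (pinned? (tops c) u))) (holdings bd u k))
  where
  e = lookup (exact c) u
  spill-≤ : spill c u k ≤ e
  spill-≤ with does (spilled? c u k)
  ... | true  = ≤-refl
  ... | false = z≤n
  moved : Dec (Pinned (tops c) u) → spill c u k + kept c u ≤ e
  moved (yes p) = ≤-reflexive (cong₂ _+_ (spill-miss c u k (λ s → proj₂ s p)) (kept-pinned c p))
  moved (no ¬p) = subst (λ z → spill c u k + z ≤ e) (sym (kept-unpinned c ¬p))
    (subst (_≤ e) (sym (+-identityʳ _)) spill-≤)
charges (close-bounded _ bd) = charges bd
position (close-bounded {B = B} {c = c} full bd) = trans (+-identityʳ _)
  (trans (+-comm B (length (older c) * B)) (trans (cong (length (older c) * B +_) (sym full)) (position bd)))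
support (close-bounded {c = c} _ _) u u∉tops _ =
  trans (lookup∘tabulate (kept c) u) (kept-unpinned c (λ p → u∉tops (there (pinned⇒∈ p))))

settle-bounded : ∀ {n B t} {s : State (suc n) (Ledger (suc n))} → 0 < B → length (recent (ctrl s)) ≤ B → Bounded B t s →
  Bounded B t (settle B _⊕_ s) × length (recent (ctrl (settle B _⊕_ s))) < B
settle-bounded {B = B} {s = state c _ _} 0<B ≤B bd with length (recent c) ≟ B
... | yes full = close-bounded full bd , 0<B
... | no ≢B    = bd , ≤∧≢⇒< ≤B ≢B

advance-bounded : ∀ {n B t} {s s′ : State (suc n) (Ledger (suc n))} y → advance B _⊕_ s y ≡ just s′ →
  Bounded B t s × length (recent (ctrl s)) < B → Bounded B (suc t) s′ × length (recent (ctrl s′)) < B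
advance-bounded {s = state c A X} (ins u) refl (bd , room) =
  settle-bounded (≤-<-trans z≤n room) room (add-bounded bd u)
advance-bounded {s = state c A X} (ext v) eq (bd , room) with admissible? c v
advance-bounded {s = state c A X} (ext v) refl (bd , room) | yes adm =
  settle-bounded (≤-<-trans z≤n room) room (extract-bounded bd adm)

-- Encoding of the working memory

record Code (A : Set) : Set₁ where
  field
    width         : ℕ
    Fits          : A → Set
    encode        : A → Vec Bool width
    decode        : Vec Bool width → A
    decode-encode : ∀ {a} → Fits a → decode (encode a) ≡ a

open Code

ℕ-code : ℕ → Code ℕ
ℕ-code w = record
  { width = w ; Fits = _< 2 ^ w ; encode = toBits w ; decode = fromBits ; decode-encode = fromBits-toBits w }

Fin-code : ∀ n w → Code (Fin (suc n))
Fin-code n w = record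
  { width = w ; Fits = λ _ → suc n ≤ 2 ^ w ; encode = toBits w ∘ toℕ ; decode = λ v → read-back (fromBits v)
  ; decode-encode = λ {u} fits → trans
      (cong read-back (fromBits-toBits w (<-≤-trans (Fin.toℕ<n u) fits))) (read-back-toℕ u) }
  where
  read-back : ℕ → Fin (suc n)
  read-back m with m <? suc n
  ... | yes m<n = fromℕ< m<n
  ... | no _    = zero
  read-back-toℕ : ∀ u → read-back (toℕ u) ≡ u
  read-back-toℕ u with toℕ u <? suc n
  ... | yes u<n = Fin.fromℕ<-toℕ u u<n
  ... | no u≮n  = contradiction (Fin.toℕ<n u) u≮n

_×-code_ : ∀ {A B} → Code A → Code B → Code (A × B)
C ×-code D = record
  { width = width C + width D
  ; Fits = λ (a , b) → Fits C a × Fits D b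
  ; encode = λ (a , b) → encode C a ++ encode D b
  ; decode = λ v → decode C (take (width C) v) , decode D (drop (width C) v)
  ; decode-encode = λ {(a , b)} (fits-a , fits-b) → cong₂ _,_
      (trans (cong (decode C) (take-++ (encode C a) _)) (decode-encode C fits-a))
      (trans (cong (decode D) (drop-++ (encode C a) _)) (decode-encode D fits-b)) }

Maybe-code : ∀ {A} → Code A → Code (Maybe A)
Maybe-code {A} C = record
  { width = suc (width C) ; Fits = Maybe.maybe′ (Fits C) ⊤
  ; encode = enc ; decode = dec ; decode-encode = λ {m} → dec-enc m }
  where
  enc : Maybe A → Vec Bool (suc (width C))
  enc (just a) = true ∷ encode C a
  enc nothing  = replicate _ false
  dec : Vec Bool (suc (width C)) → Maybe A
  dec (true ∷ v)  = just (decode C v)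
  dec (false ∷ v) = nothing
  dec-enc : ∀ m → Maybe.maybe′ (Fits C) ⊤ m → dec (enc m) ≡ m
  dec-enc (just a) fits = cong just (decode-encode C fits)
  dec-enc nothing  _    = refl

List-code : ∀ {A} → Code A → ℕ → Code (List A)
List-code {A} C k = record
  { width = k * suc (width C) ; Fits = λ xs → length xs ≤ k × All (Fits C) xs
  ; encode = enc k ; decode = dec k ; decode-encode = λ (len , fits) → dec-enc k len fits }
  where
  enc : ∀ k → List A → Vec Bool (k * suc (width C))
  enc zero    _        = []
  enc (suc k) []       = replicate _ false
  enc (suc k) (x ∷ xs) = (true ∷ encode C x) ++ enc k xs
  dec : ∀ k → Vec Bool (k * suc (width C)) → List A
  dec zero    _           = []
  dec (suc k) (false ∷ v) = []
  dec (suc k) (true ∷ v)  = decode C (take (width C) v) ∷ dec k (drop (width C) v)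
  dec-enc : ∀ k {xs} → length xs ≤ k → All (Fits C) xs → dec k (enc k xs) ≡ xs
  dec-enc zero    {[]}     _         _             = refl
  dec-enc (suc k) {[]}     _         _             = refl
  dec-enc (suc k) {x ∷ xs} (s≤s len) (fit ∷ fits) = cong₂ _∷_
    (trans (cong (decode C) (take-++ (encode C x) _)) (decode-encode C fit))
    (trans (cong (dec k) (drop-++ (encode C x) _)) (dec-enc k len fits))

retract-code : ∀ {A B} → (A → B) → (B → A) → Code B → Code A
retract-code f g C = record
  { width = width C ; Fits = λ a → g (f a) ≡ a × Fits C (f a)
  ; encode = encode C ∘ f ; decode = g ∘ decode C
  ; decode-encode = λ (gf≡id , fits) → trans (cong g (decode-encode C fits)) gf≡id }

-- exact is stored only at the elements listed in top, older and recent, which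
-- carry all of it.
assoc : ∀ {U} → List (Fin U × ℕ) → Fin U → ℕ
assoc []             u = 0
assoc ((w , e) ∷ xs) u with w Fin.≟ u
... | yes _ = e
... | no _  = assoc xs u

-- An element may be listed repeatedly, but always with the same value, so the first occurrence
-- decides.
assoc-map : ∀ {U} (f : Fin U → ℕ) ws {u} → (u ∉ ws → f u ≡ 0) → assoc (List.map (λ w → w , f w) ws) u ≡ f u
assoc-map f []           absent = sym (absent λ ())
assoc-map f (w ∷ ws) {u} absent with w Fin.≟ u
... | yes refl = refl
... | no w≢u   = assoc-map f ws λ u∉ws → absent λ { (here eq) → w≢u (sym eq) ; (there u∈ws) → u∉ws u∈ws }

Compressed : ℕ → Set
Compressed U = ((Fin U × ℕ) × List (Fin U × ℕ)) × List (Fin U × ℕ)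

compress : ∀ {U} → Control U → Compressed U
compress c = (holding (top c) , List.map holding (older c)) , List.map holding (recent c)
  where holding = λ u → u , lookup (exact c) u

decompress : ∀ {U} → Compressed U → Control U
decompress ((x , xs) , ys) = control (proj₁ x) (List.map proj₁ xs) (List.map proj₁ ys)
  (tabulate (assoc ((x ∷ xs) List.++ ys)))

decompress-compress : ∀ {U} (c : Control U) → (∀ u → u ∉ tops c → u ∉ recent c → lookup (exact c) u ≡ 0) →
  decompress (compress c) ≡ c
decompress-compress {U} c support = cong₃ (control (top c)) (keys (older c)) (keys (recent c)) (begin
  tabulate (assoc (List.map holding (tops c) List.++ List.map holding (recent c)))
    ≡⟨ cong (tabulate ∘ assoc) (map-++ holding (tops c) (recent c)) ⟨
  tabulate (assoc (List.map holding (tops c List.++ recent c)))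
    ≡⟨ tabulate-cong (λ u → assoc-map (lookup (exact c)) (tops c List.++ recent c)
         λ u∉ → support u (u∉ ∘ ∈-++⁺ˡ) (u∉ ∘ ∈-++⁺ʳ (tops c))) ⟩
  tabulate (lookup (exact c))   ≡⟨ tabulate∘lookup (exact c) ⟩
  exact c                       ∎)
  where
  open ≡-Reasoning
  holding : Fin U → Fin U × ℕ
  holding u = u , lookup (exact c) u
  keys : ∀ ws → List.map proj₁ (List.map holding ws) ≡ ws
  keys ws = trans (sym (map-∘ ws)) (map-id ws)
  cong₃ : ∀ {A B C D : Set} (f : A → B → C → D) {a a′ b b′ c c′} → a ≡ a′ → b ≡ b′ → c ≡ c′ → f a b c ≡ f a′ b′ c′
  cong₃ f refl refl refl = refl

-- Ledgers as coefficient functions on bit strings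

module Keys (n lu lk : ℕ) where

  extend : Ledger (suc n) → ℕ → ℕ → ℕ
  extend L a k with a <? suc n
  ... | yes a<n = L (fromℕ< a<n) k
  ... | no _    = 0

  pull : Ledger (suc n) → Vec Bool (lu + lk) → ℕ
  pull L x = extend L (fromBits (take lu x)) (fromBits (drop lu x))

  pull-⊕ : ∀ A A′ x → pull (A ⊕ A′) x ≡ pull A x + pull A′ x
  pull-⊕ A A′ x with fromBits (take lu x) <? suc n
  ... | yes _ = refl
  ... | no _  = refl

  pull-cong : ∀ {A A′} → (∀ u k → A u k ≡ A′ u k) → pull A ≗ pull A′
  pull-cong eq x with fromBits (take lu x) <? suc n
  ... | yes _ = eq _ _
  ... | no _  = refl

  pull-≤ : ∀ {A m} → (∀ u k → A u k ≤ m) → ∀ x → pull A x ≤ m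
  pull-≤ A≤m x with fromBits (take lu x) <? suc n
  ... | yes _ = A≤m _ _
  ... | no _  = z≤n

  pull-key : ∀ A u k → suc n ≤ 2 ^ lu → k < 2 ^ lk → pull A (toBits lu (toℕ u) ++ toBits lk k) ≡ A u k
  pull-key A u k fits-u fits-k = begin
    pull A (toBits lu (toℕ u) ++ toBits lk k)
      ≡⟨ cong₂ (λ v w → extend A (fromBits v) (fromBits w)) (take-++ (toBits lu (toℕ u)) _) (drop-++ (toBits lu (toℕ u)) _) ⟩
    extend A (fromBits (toBits lu (toℕ u))) (fromBits (toBits lk k))
      ≡⟨ cong₂ (extend A) (fromBits-toBits lu (<-≤-trans (Fin.toℕ<n u) fits-u)) (fromBits-toBits lk fits-k) ⟩
    extend A (toℕ u) k   ≡⟨ extend-toℕ ⟩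
    A u k                ∎
    where
    open ≡-Reasoning
    extend-toℕ : extend A (toℕ u) k ≡ A u k
    extend-toℕ with toℕ u <? suc n
    ... | yes u<n = cong (λ w → A w k) (Fin.fromℕ<-toℕ u u<n)
    ... | no u≮n  = contradiction (Fin.toℕ<n u) u≮n

  -- A charge touches only the key formed by v and its tag. Summed over the run, this bounds by N
  -- the mass that governs the fingerprint error.
  charge-mass : ∀ c y → sum (pull (charge c y)) ≤ 1
  charge-mass c y = sum-≤1 {lu + lk} (pull-≤ (charge-≤1 c y)) (unique y)
    where
    location : ∀ v x → 0 < pull (charge c (ext v)) x →
      fromBits (take lu x) ≡ toℕ v × fromBits (drop lu x) ≡ tag (tops c) v
    location v x pos with fromBits (take lu x) <? suc n
    ... | yes u<n with charged? c v (fromℕ< u<n) (fromBits (drop lu x))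
    ...   | yes (u≡v , k≡tag , _) = trans (sym (Fin.toℕ-fromℕ< u<n)) (cong toℕ u≡v) , k≡tag
    ...   | no ¬charged = contradiction (charge-miss c v _ _ ¬charged) (≢-sym (<⇒≢ pos))
    unique : ∀ y x x′ → 0 < pull (charge c y) x → 0 < pull (charge c y) x′ → x ≡ x′
    unique (ins u) x x′ pos _ = contradiction pos (<-irrefl (sym (n≤0⇒n≡0 (pull-≤ {A = charge c (ins u)} (λ _ _ → z≤n) x))))
    unique (ext v) x x′ pos pos′ with location v x pos | location v x′ pos′
    ... | eq₁ , eq₂ | eq₁′ , eq₂′ = trans (sym (take++drop≡id lu x)) (trans
      (cong₂ (Vec._++_ {m = lu} {lk})
        (fromBits-injective {v = take lu x} {take lu x′} (trans eq₁ (sym eq₁′)))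
        (fromBits-injective {v = drop lu x} {drop lu x′} (trans eq₂ (sym eq₂′))))
      (take++drop≡id lu x′))

-- The streaming algorithm

module Checker (n N B lu lk b wN : ℕ) where

  open Keys n lu lk

  ℓ : ℕ
  ℓ = lu + lk

  fingerprint : Vec Bool (ℓ * b) → Ledger (suc n) → ℕ
  fingerprint r L = eval {b} ℓ r (pull L)

  add-eval : Vec Bool (ℓ * b) → ℕ → Ledger (suc n) → ℕ
  add-eval r h L = h + fingerprint r L

  measure : Vec Bool (ℓ * b) → State (suc n) (Ledger (suc n)) → State (suc n) ℕ
  measure r s = state (ctrl s) (fingerprint r (spilled s)) (fingerprint r (charged s))

  init : State (suc n) (Ledger (suc n))
  init = state (control zero [] [] ∅) (λ _ _ → 0) (λ _ _ → 0)

  entry-code : Code (Fin (suc n) × ℕ)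
  entry-code = Fin-code n lu ×-code ℕ-code wN

  control-code : Code (Control (suc n))
  control-code = retract-code compress decompress
    ((entry-code ×-code List-code entry-code B) ×-code List-code entry-code B)

  sum-code : Code ℕ
  sum-code = ℕ-code (wN + ℓ * suc b)

  state-code : Code (Maybe (State (suc n) ℕ))
  state-code = Maybe-code (retract-code
    (λ s → ctrl s , spilled s , charged s) (λ (c , a , x) → state c a x)
    (control-code ×-code (sum-code ×-code sum-code)))

  verdict : Maybe (State (suc n) ℕ) → Bool
  verdict nothing  = false
  verdict (just s) = does (≡-dec _≟_ (exact (ctrl s)) ∅) ∧ (spilled s ≡ᵇ charged s)

  -- The evaluation point is drawn once and kept in memory, since coins are otherwise lost. After an
  -- inadmissible extraction the state stays `nothing`.
  checker : StreamingAlgorithm (Symbol (suc n))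
  checker = record
    { memory = ℓ * b + width state-code
    ; coins  = ℓ * b
    ; start  = λ r → r ++ encode state-code (just (measure r init))
    ; step   = λ _ m y → let r = take (ℓ * b) m in
        r ++ encode state-code (decode state-code (drop (ℓ * b) m) >>= λ s → advance B (add-eval r) s y)
    ; accept = λ m → verdict (decode state-code (drop (ℓ * b) m))
    }

  eval-pull-⊕ : ∀ r A A′ → fingerprint r (A ⊕ A′) ≡ fingerprint r A + fingerprint r A′
  eval-pull-⊕ r A A′ = trans (eval-cong ℓ r (pull-⊕ A A′)) (eval-+ ℓ r (pull A) (pull A′))

  measure-settle : ∀ r s → settle B (add-eval r) (measure r s) ≡ measure r (settle B _⊕_ s)
  measure-settle r (state c A X) with length (recent c) ≟ B
  ... | yes _ = cong (λ a → state (close c) a (fingerprint r X)) (sym (eval-pull-⊕ r A (spill c)))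
  ... | no _  = refl

  -- The control evolves without looking at the fingerprints, and these are additive in the ledgers,
  -- so measuring commutes with a step.
  measure-advance : ∀ r s y → advance B (add-eval r) (measure r s) y ≡ Maybe.map (measure r) (advance B _⊕_ s y)
  measure-advance r (state c A X) y with read c y
  ... | nothing = refl
  ... | just c′ = cong just (trans
    (cong (λ x → settle B (add-eval r) (state {suc n} c′ (fingerprint r A) x)) (sym (eval-pull-⊕ r X (charge c y))))
    (measure-settle r (state c′ A (X ⊕ charge c y))))

  runFrom-nothing : ∀ {M} r (σ : Vec (Symbol (suc n)) M) r′ →
    runFrom checker (r ++ encode state-code nothing) σ r′ ≡ false
  runFrom-nothing r []      r′ = cong (verdict ∘ decode state-code) (drop-++ r (encode state-code nothing))
  runFrom-nothing r (y ∷ σ) r′ = trans (cong (λ m → runFrom checker m σ (drop (ℓ * b) r′)) step≡) (runFrom-nothing r σ (drop (ℓ * b) r′))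
    where
    step≡ : step checker (take (ℓ * b) r′) (r ++ encode state-code nothing) y ≡ r ++ encode state-code nothing
    step≡ = cong₂ (λ r x → r ++ encode state-code x) (take-++ r dead)
      (cong₂ (λ r v → decode state-code v >>= λ s → advance B (add-eval r) s y) (take-++ r dead) (drop-++ r dead))
      where dead = encode state-code nothing

  module _ (0<B : 0 < B) (N≤B² : N ≤ B * B) (fits-U : suc n ≤ 2 ^ lu) (fits-N : N < 2 ^ wN) where

    measure-fits : ∀ r {t s} → Bounded B t s → length (recent (ctrl s)) < B → t ≤ N → Fits state-code (just (measure r s))
    measure-fits r {t} {s} bd room t≤N = refl , (decompress-compress c (support bd) , (fits-entry (top c) , older-≤ , fits-entries (older c))
                                  , recent-≤ , fits-entries (recent c))
                          , fits-sum (holdings-≤ bd) , fits-sum (charges bd)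
      where
      c = ctrl s
      holdings-≤ : ∀ {s} → Bounded B t s → ∀ u k → spilled s u k ≤ t
      holdings-≤ bd u k = m+n≤o⇒m≤o _ (holdings bd u k)
      fits-entry : ∀ u → Fits entry-code (u , lookup (exact c) u)
      fits-entry u = fits-U , ≤-<-trans (≤-trans (m+n≤o⇒n≤o (spilled s u 0) (holdings bd u 0)) t≤N) fits-N
      fits-entries : ∀ us → All (Fits entry-code) (List.map (λ u → u , lookup (exact c) u) us)
      fits-entries us = All.map⁺ (All.universal fits-entry us)
      -- Each closed block took B symbols, so `length (older c) * B` is at most N, hence at most B *
      -- B.
      older-≤ : length (List.map (λ u → u , lookup (exact c) u) (older c)) ≤ B
      older-≤ = subst (_≤ B) (sym (length-map _ (older c)))
        (*-cancelʳ-≤ _ _ B {{>-nonZero 0<B}} (≤-trans (m+n≤o⇒m≤o _ (≤-reflexive (position bd))) (≤-trans t≤N N≤B²)))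
      recent-≤ : length (List.map (λ u → u , lookup (exact c) u) (recent c)) ≤ B
      recent-≤ = subst (_≤ B) (sym (length-map _ (recent c))) (<⇒≤ room)
      fits-sum : ∀ {A : Ledger (suc n)} → (∀ u k → A u k ≤ t) → fingerprint r A < 2 ^ (wN + ℓ * suc b)
      fits-sum {A} A≤t = begin-strict
        fingerprint r A             ≤⟨ eval-≤ ℓ r (pull-≤ {A} A≤t) ⟩
        t * 2 ^ (ℓ * suc b)           <⟨ *-monoˡ-< _ {{m^n≢0 2 (ℓ * suc b)}} (≤-<-trans t≤N fits-N) ⟩
        2 ^ wN * 2 ^ (ℓ * suc b)      ≡⟨ ^-distribˡ-+-* 2 wN (ℓ * suc b) ⟨
        2 ^ (wN + ℓ * suc b)          ∎
        where open ≤-Reasoning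

    runFrom-measure : ∀ {M} r {t s} (σ : Vec (Symbol (suc n)) M) r′ →
      Bounded B t s × length (recent (ctrl s)) < B → t + M ≤ N →
      runFrom checker (r ++ encode state-code (just (measure r s))) σ r′ ≡
      verdict (Maybe.map (measure r) (process B _⊕_ s σ))
    runFrom-measure {zero} r {t} {s} [] r′ (bd , room) t+M≤N = cong verdict (trans
      (cong (decode state-code) (drop-++ r (encode state-code (just (measure r s)))))
      (decode-encode state-code {just (measure r s)} (measure-fits r {s = s} bd room (m+n≤o⇒m≤o t t+M≤N))))
    runFrom-measure {suc M} r {t} {s} (y ∷ σ) r′ inv@(bd , room) t+M≤N =
      trans (cong (λ m → runFrom checker m σ (drop (ℓ * b) r′)) step≡) (continue (advance B _⊕_ s y) (λ eq → advance-bounded y eq inv))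
      where
      decoded : decode state-code (drop (ℓ * b) (r ++ encode state-code (just (measure r s)))) ≡ just (measure r s)
      decoded = trans (cong (decode state-code) (drop-++ r (encode state-code (just (measure r s)))))
        (decode-encode state-code {just (measure r s)} (measure-fits r {s = s} bd room (m+n≤o⇒m≤o t t+M≤N)))
      step≡ : step checker (take (ℓ * b) r′) (r ++ encode state-code (just (measure r s))) y ≡
              r ++ encode state-code (Maybe.map (measure r) (advance B _⊕_ s y))
      step≡ = cong₂ (λ r x → r ++ encode state-code x) (take-++ r (encode state-code (just (measure r s))))
        (trans (cong₂ (λ r x → x >>= λ s → advance B (add-eval r) s y) (take-++ r (encode state-code (just (measure r s)))) decoded) (measure-advance r s y))
      continue : ∀ x → (∀ {s′} → x ≡ just s′ → Bounded B (suc t) s′ × length (recent (ctrl s′)) < B) →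
        runFrom checker (r ++ encode state-code (Maybe.map (measure r) x)) σ (drop (ℓ * b) r′) ≡
        verdict (Maybe.map (measure r) (x >>= λ s′ → process B _⊕_ s′ σ))
      continue nothing   _   = runFrom-nothing r σ (drop (ℓ * b) r′)
      continue (just s′) inv = runFrom-measure r σ (drop (ℓ * b) r′) (inv refl) (subst (_≤ N) (+-suc t M) t+M≤N)

    init-bounded : Bounded B 0 init
    init-bounded = record
      { holdings = λ u k → ≤-reflexive (lookup-∅ u) ; charges = λ _ _ → z≤n
      ; position = refl ; support = λ u _ _ → lookup-∅ u }

    init-consistent : Consistent ∅ init
    init-consistent = record { balance = λ _ → refl ; solvent = λ _ → z≤n ; fresh = λ _ _ _ → refl , refl }

    run-verdict : ∀ (σ : Vec (Symbol (suc n)) N) r →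
      run checker σ r ≡ verdict (Maybe.map (measure (take (ℓ * b) r)) (process B _⊕_ init σ))
    run-verdict σ r = runFrom-measure (take (ℓ * b) r) σ (drop (ℓ * b) r) (init-bounded , 0<B) ≤-refl

    accepts : ∀ (σ : Vec (Symbol (suc n)) N) → PQ σ → ∀ r → run checker σ r ≡ true
    accepts σ pq r with complete B {s = init} σ init-consistent (λ _ _ _ → refl) (PQFrom⇒Valid σ pq)
    ... | s , run≡s , same , e≡∅ = trans (run-verdict σ r)
      (trans (cong (verdict ∘ Maybe.map (measure r₀)) run≡s)
        (cong₂ _∧_ (dec-true (≡-dec _≟_ (exact (ctrl s)) ∅) e≡∅)
          (T⇒≡true (≡⇒≡ᵇ _ _ (eval-cong ℓ r₀ (pull-cong same))))))
      where
      r₀ = take (ℓ * b) r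
      T⇒≡true : ∀ {x} → T x → x ≡ true
      T⇒≡true {true} _ = refl

    process-bounded : ∀ {M} {t s s⋆} (σ : Vec (Symbol (suc n)) M) → process B _⊕_ s σ ≡ just s⋆ →
      Bounded B t s × length (recent (ctrl s)) < B → Bounded B (t + M) s⋆
    process-bounded {t = t} {s⋆ = s⋆} [] refl (bd , _) = subst (λ t → Bounded B t s⋆) (sym (+-identityʳ t)) bd
    process-bounded {suc M} {t} {s} {s⋆} (y ∷ σ) eq inv with advance B _⊕_ s y in eqs
    ... | just s′ = subst (λ t → Bounded B t s⋆) (sym (+-suc t M)) (process-bounded σ eq (advance-bounded y eqs inv))

    advance-mass : ∀ {s s′} y → advance B _⊕_ s y ≡ just s′ → sum (pull (charged s′)) ≤ suc (sum (pull (charged s)))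
    advance-mass {state c A X} y eq with read c y
    advance-mass {state c A X} y refl | just c′ = begin
      sum (pull (charged (settle B _⊕_ (state c′ A (X ⊕ charge c y)))))   ≡⟨ cong (sum ∘ pull) (settle-charged (state c′ A (X ⊕ charge c y))) ⟩
      sum (pull (X ⊕ charge c y))                        ≡⟨ sum-cong {ℓ} (pull-⊕ X (charge c y)) ⟩
      sum (λ x → pull X x + pull (charge c y) x)         ≡⟨ sum-+ {ℓ} (pull X) (pull (charge c y)) ⟩
      sum (pull X) + sum (pull (charge c y))             ≤⟨ +-monoʳ-≤ (sum (pull X)) (charge-mass c y) ⟩
      sum (pull X) + 1                                   ≡⟨ +-comm (sum (pull X)) 1 ⟩
      suc (sum (pull X))                                 ∎
      where
      open ≤-Reasoning
      settle-charged : ∀ s → charged (settle B _⊕_ s) ≡ charged s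
      settle-charged (state c _ _) with length (recent c) ≟ B
      ... | yes _ = refl
      ... | no _  = refl

    process-mass : ∀ {M s s⋆} (σ : Vec (Symbol (suc n)) M) → process B _⊕_ s σ ≡ just s⋆ →
      sum (pull (charged s⋆)) ≤ sum (pull (charged s)) + M
    process-mass [] refl = m≤m+n _ 0
    process-mass {suc M} {s} {s⋆} (y ∷ σ) eq with advance B _⊕_ s y in eqs
    ... | just s′ = begin
      sum (pull (charged s⋆))               ≤⟨ process-mass σ eq ⟩
      sum (pull (charged s′)) + M           ≤⟨ +-monoˡ-≤ M (advance-mass {s} y eqs) ⟩
      suc (sum (pull (charged s))) + M      ≡⟨ +-suc (sum (pull (charged s))) M ⟨
      sum (pull (charged s)) + suc M        ∎
      where open ≤-Reasoning

    -- Tags reach `length (tops c)`, which is at most B + 1. In `rare`, the factor N is the bound on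
    -- the charged mass and N ^ 2 the inverse of the tolerated error.
    module _ (fits-tag : suc B < 2 ^ lk) (rare : N * N ^ 2 ≤ 2 ^ b) .{{_ : NonZero N}} where

      agreeing : ∀ {s} → Bounded B N s → pull (spilled s) ≗ pull (charged s) → Agreeing s
      agreeing {s} bd pulled u k k≤t =
        trans (sym (pull-key (spilled s) u k fits-U k<2^lk)) (trans (pulled _) (pull-key (charged s) u k fits-U k<2^lk))
        where
        c = ctrl s
        older≤B : length (older c) ≤ B
        older≤B = *-cancelʳ-≤ _ _ B {{>-nonZero 0<B}} (≤-trans (m+n≤o⇒m≤o _ (≤-reflexive (position bd))) N≤B²)
        k<2^lk : k < 2 ^ lk
        k<2^lk = ≤-<-trans (≤-trans k≤t (≤-trans (tag-≤ (tops c) u) (s≤s older≤B))) fits-tag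

      -- The exact run is fixed before any coins are counted. If it ends with no explicit copies,
      -- `sound` forbids equal ledgers outside PQ, so acceptance requires a fingerprint collision.
      accepting-coins : ∀ (σ : Vec (Symbol (suc n)) N) → ¬ PQ σ →
        count (λ r → verdict (Maybe.map (measure r) (process B _⊕_ init σ))) * N ^ 2 ≤ 2 ^ (ℓ * b)
      accepting-coins σ ¬pq with process B _⊕_ init σ in run≡
      ... | nothing = ≤-trans (≤-reflexive (cong (_* N ^ 2) (count-false (ℓ * b)))) z≤n
      ... | just s with ≡-dec _≟_ (exact (ctrl s)) ∅
      ...   | no _    = ≤-trans (≤-reflexive (cong (_* N ^ 2) (count-false (ℓ * b)))) z≤n
      ...   | yes e≡∅ with fingerprint-error {b} ℓ (pull (spilled s)) (pull (charged s))
      ...     | inj₁ pulled = contradiction (Valid⇒PQFrom σ (sound B {s = init} σ init-consistent run≡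
                  (agreeing (process-bounded σ run≡ (init-bounded , 0<B)) pulled) e≡∅)) ¬pq
      ...     | inj₂ few = *-cancelˡ-≤ N (begin
        N * (bad * N ^ 2)                        ≡⟨ solve 3 (λ n c m → n :* (c :* m) := c :* (n :* m)) refl N bad (N ^ 2) ⟩
        bad * (N * N ^ 2)                        ≤⟨ *-monoʳ-≤ bad rare ⟩
        bad * 2 ^ b                              ≤⟨ few ⟩
        sum (pull (charged s)) * 2 ^ (ℓ * b)     ≤⟨ *-monoˡ-≤ (2 ^ (ℓ * b)) mass≤N ⟩
        N * 2 ^ (ℓ * b)                          ∎)
        where
        open ≤-Reasoning
        bad = count {ℓ * b} (λ r → eval ℓ r (pull (spilled s)) ≡ᵇ eval ℓ r (pull (charged s)))
        init-mass : sum (pull (charged init)) ≤ 0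
        init-mass = ≤-trans (sum-mono {ℓ} (pull-≤ {charged init} (λ _ _ → z≤n)))
          (≤-reflexive (trans (sum-const ℓ 0) (*-zeroʳ (2 ^ ℓ))))
        mass≤N : sum (pull (charged s)) ≤ N
        mass≤N = ≤-trans (process-mass σ run≡) (+-monoˡ-≤ N init-mass)

      rejects : ∀ (σ : Vec (Symbol (suc n)) N) → ¬ PQ σ → count (run checker σ) * N ^ 2 ≤ 2 ^ (suc N * (ℓ * b))
      rejects σ ¬pq = begin
        count (run checker σ) * N ^ 2          ≡⟨ cong (_* N ^ 2) (count-cong (run-verdict σ)) ⟩
        count (V ∘ take (ℓ * b)) * N ^ 2       ≡⟨ cong (_* N ^ 2) (count-take (ℓ * b) {N * (ℓ * b)} V) ⟩
        2 ^ (N * (ℓ * b)) * count V * N ^ 2    ≡⟨ *-assoc (2 ^ (N * (ℓ * b))) (count V) (N ^ 2) ⟩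
        2 ^ (N * (ℓ * b)) * (count V * N ^ 2)  ≤⟨ *-monoʳ-≤ (2 ^ (N * (ℓ * b))) (accepting-coins σ ¬pq) ⟩
        2 ^ (N * (ℓ * b)) * 2 ^ (ℓ * b)        ≡⟨ *-comm (2 ^ (N * (ℓ * b))) _ ⟩
        2 ^ (ℓ * b) * 2 ^ (N * (ℓ * b))        ≡⟨ ^-distribˡ-+-* 2 (ℓ * b) (N * (ℓ * b)) ⟨
        2 ^ (suc N * (ℓ * b))                  ∎
        where
        open ≤-Reasoning
        V : Vec Bool (ℓ * b) → Bool
        V r = verdict (Maybe.map (measure r) (process B _⊕_ init σ))

-- Error probability and space

open import Data.Integer as ℤ using (+_)
import Data.Integer.Properties as ℤ
open import Data.Rational.Unnormalised as ℚ using (1ℚᵘ; _-_; _/_; *≤*)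

count-not : ∀ {n} (E : Vec Bool n → Bool) → count E + count (not ∘ E) ≡ 2 ^ n
count-not {zero} E with E []
... | true  = refl
... | false = refl
count-not {suc n} E = begin
  (a + b) + (c + d)   ≡⟨ solve 4 (λ a b c d → (a :+ b) :+ (c :+ d) := (a :+ c) :+ (b :+ d)) refl a b c d ⟩
  (a + c) + (b + d)   ≡⟨ cong₂ _+_ (count-not (E ∘ (false ∷_))) (count-not (E ∘ (true ∷_))) ⟩
  2 ^ n + 2 ^ n       ≡⟨ 2*m≡m+m (2 ^ n) ⟨
  2 ^ suc n           ∎
  where
  open ≡-Reasoning
  a = count (E ∘ (false ∷_))
  b = count (E ∘ (true ∷_))
  c = count (not ∘ E ∘ (false ∷_))
  d = count (not ∘ E ∘ (true ∷_))

1-1/D≤c/T : ∀ a c D T .{{_ : NonZero D}} .{{_ : NonZero T}} → a + c ≡ T → a * D ≤ T →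
            1ℚᵘ - (+ 1) / D ℚ.≤ (+ c) / T
-- With D = 1 + d, the difference on the left has numerator d, and cross-multiplication leaves d * T
-- ≤ c * D. The added zeros come from unfolding the rational arithmetic.
1-1/D≤c/T a c (suc d) (suc t) a+c≡T aD≤T = *≤* (subst₂ ℤ._≤_
  (trans (cong (λ z → + (z * suc t)) (sym (+-identityʳ d))) (ℤ.pos-* (d + 0) (suc t)))
  (trans (cong (λ z → + (c * suc z)) (sym (+-identityʳ d))) (ℤ.pos-* c (suc (d + 0))))
  (ℤ.+≤+ (+-cancelʳ-≤ (a * suc d) (d * suc t) (c * suc d) (begin
    d * suc t + a * suc d    ≤⟨ +-monoʳ-≤ (d * suc t) aD≤T ⟩
    d * suc t + suc t        ≡⟨ +-comm (d * suc t) (suc t) ⟩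
    suc d * suc t            ≡⟨ *-comm (suc d) (suc t) ⟩
    suc t * suc d            ≡⟨ cong (_* suc d) a+c≡T ⟨
    (a + c) * suc d          ≡⟨ solve 3 (λ a c d → (a :+ c) :* d := c :* d :+ a :* d) refl a c (suc d) ⟩
    c * suc d + a * suc d    ∎))))
  where open ≤-Reasoning

Pr-not : ∀ {n} (E : Vec Bool n → Bool) D .{{_ : NonZero D}} → count E * D ≤ 2 ^ n →
         1ℚᵘ - (+ 1) / D ℚ.≤ Pr (not ∘ E)
Pr-not {n} E D few = 1-1/D≤c/T (count E) (count (not ∘ E)) D (2 ^ n) {{_}} {{m^n≢0 2 n}} (count-not E) few

n<2^[1+⌊log₂n⌋] : ∀ n → n < 2 ^ suc ⌊log₂ n ⌋
n<2^[1+⌊log₂n⌋] n with n <? 2 ^ suc ⌊log₂ n ⌋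
... | yes n<  = n<
... | no n≮   = contradiction
  (subst (_≤ ⌊log₂ n ⌋) (⌊log₂[2^n]⌋≡n (suc ⌊log₂ n ⌋)) (⌊log₂⌋-mono-≤ (≮⇒≥ n≮))) (n≮n _)

⌊n/2⌋+⌊n/2⌋≤n : ∀ n → ⌊ n /2⌋ + ⌊ n /2⌋ ≤ n
⌊n/2⌋+⌊n/2⌋≤n n = ≤-trans (+-monoʳ-≤ ⌊ n /2⌋ (⌊n/2⌋-mono (n≤1+n n))) (≤-reflexive (⌊n/2⌋+⌈n/2⌉≡n n))

n≤1+⌊n/2⌋+⌊n/2⌋ : ∀ n → n ≤ suc (⌊ n /2⌋ + ⌊ n /2⌋)
n≤1+⌊n/2⌋+⌊n/2⌋ zero          = z≤n
n≤1+⌊n/2⌋+⌊n/2⌋ (suc zero)    = s≤s z≤n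
n≤1+⌊n/2⌋+⌊n/2⌋ (suc (suc n)) = s≤s (subst (suc n ≤_) (sym (+-suc (suc ⌊ n /2⌋) ⌊ n /2⌋)) (s≤s (n≤1+⌊n/2⌋+⌊n/2⌋ n)))

2^⌊log₂n⌋≤n : ∀ n .{{_ : NonZero n}} → 2 ^ ⌊log₂ n ⌋ ≤ n
2^⌊log₂n⌋≤n n = bound ⌊log₂ n ⌋ n refl
  where
  bound : ∀ L n .{{_ : NonZero n}} → ⌊log₂ n ⌋ ≡ L → 2 ^ L ≤ n
  bound zero    n             _  = >-nonZero⁻¹ n
  bound (suc L) (suc zero)    ()
  bound (suc L) (suc (suc n)) eq = begin
    2 ^ suc L                                   ≡⟨ 2*m≡m+m (2 ^ L) ⟩
    2 ^ L + 2 ^ L                               ≤⟨ +-mono-≤ half half ⟩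
    ⌊ 2 + n /2⌋ + ⌊ 2 + n /2⌋                   ≤⟨ ⌊n/2⌋+⌊n/2⌋≤n (2 + n) ⟩
    2 + n                                       ∎
    where
    open ≤-Reasoning
    half : 2 ^ L ≤ ⌊ 2 + n /2⌋
    half = bound L ⌊ 2 + n /2⌋ (trans (⌊log₂⌊n/2⌋⌋≡⌊log₂n⌋∸1 (2 + n)) (cong (_∸ 1) eq))

n≤2^n : ∀ n → n ≤ 2 ^ n
n≤2^n zero    = z≤n
n≤2^n (suc n) = subst (suc n ≤_) (sym (2*m≡m+m (2 ^ n))) (+-mono-≤ (m^n>0 2 n) (n≤2^n n))

module Parameters (N n : ℕ) where

  -- B is a power of two between √N and 2√N. Then 2 ^ lk = 2 * B leaves room for the tags up to B +
  -- 1, and b = 3 * wN gives 2 ^ b ≥ N ^ 3.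
  LU LN q B lu lk wN b : ℕ
  LU = ⌊log₂ suc n ⌋
  LN = ⌊log₂ N ⌋
  q  = ⌊ LN /2⌋
  B  = 2 ^ suc q
  lu = suc LU
  lk = suc (suc q)
  wN = suc LN
  b  = wN * 3

  open Checker n N B lu lk b wN public

  0<B : 0 < B
  0<B = m^n>0 2 (suc q)

  N≤B² : N ≤ B * B
  N≤B² = begin
    N                     ≤⟨ <⇒≤ (n<2^[1+⌊log₂n⌋] N) ⟩
    2 ^ suc LN            ≤⟨ ^-monoʳ-≤ 2 (s≤s (n≤1+⌊n/2⌋+⌊n/2⌋ LN)) ⟩
    2 ^ suc (suc (q + q)) ≡⟨ cong (2 ^_) (cong suc (+-suc q q)) ⟨
    2 ^ (suc q + suc q)   ≡⟨ ^-distribˡ-+-* 2 (suc q) (suc q) ⟩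
    B * B                 ∎
    where open ≤-Reasoning

  B²≤4N : .{{_ : NonZero N}} → B * B ≤ 4 * N
  B²≤4N = begin
    B * B                 ≡⟨ ^-distribˡ-+-* 2 (suc q) (suc q) ⟨
    2 ^ (suc q + suc q)   ≡⟨ cong (2 ^_) (cong suc (+-suc q q)) ⟩
    2 ^ (2 + (q + q))     ≡⟨ ^-distribˡ-+-* 2 2 (q + q) ⟩
    4 * 2 ^ (q + q)       ≤⟨ *-monoʳ-≤ 4 (^-monoʳ-≤ 2 (⌊n/2⌋+⌊n/2⌋≤n LN)) ⟩
    4 * 2 ^ LN            ≤⟨ *-monoʳ-≤ 4 (2^⌊log₂n⌋≤n N) ⟩
    4 * N                 ∎
    where open ≤-Reasoning

  fits-U : suc n ≤ 2 ^ lu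
  fits-U = <⇒≤ (n<2^[1+⌊log₂n⌋] (suc n))

  fits-N : N < 2 ^ wN
  fits-N = n<2^[1+⌊log₂n⌋] N

  fits-tag : suc B < 2 ^ lk
  fits-tag = begin-strict
    1 + B     <⟨ +-monoˡ-< B (^-monoʳ-≤ 2 (s≤s (z≤n {q}))) ⟩
    B + B     ≡⟨ 2*m≡m+m B ⟨
    2 ^ lk    ∎
    where open ≤-Reasoning

  rare : N * N ^ 2 ≤ 2 ^ b
  rare = ≤-trans (^-monoˡ-≤ 3 (<⇒≤ fits-N)) (≤-reflexive (^-*-assoc 2 wN 3))

  -- Everything is compared with Q = (LU + LN) * B. The lists hold B entries of O(LU + LN) bits; the
  -- coins and sums, of order (LU + LN) * LN, fit because wN ≤ 2 * B. The hypothesis 1 ≤ LN absorbs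
  -- additive constants.
  space-≤ : 1 ≤ LN → space checker ≤ 128 * ((LU + LN) * B)
  space-≤ 1≤LN = begin
    ℓ * b + width state-code + ℓ * b
      ≤⟨ +-mono-≤ (+-mono-≤ coins-≤ (s≤s (+-mono-≤ (+-mono-≤ (+-mono-≤ e≤3Q list-≤) list-≤) (+-mono-≤ sum-≤ sum-≤)))) coins-≤ ⟩
    28 * Q + suc (3 * Q + 4 * Q + 4 * Q + (30 * Q + 30 * Q)) + 28 * Q
      ≤⟨ +-monoˡ-≤ (28 * Q) (+-monoʳ-≤ (28 * Q) (+-monoˡ-≤ _ 1≤Q)) ⟩
    28 * Q + (Q + (3 * Q + 4 * Q + 4 * Q + (30 * Q + 30 * Q))) + 28 * Q
      ≡⟨ solve 1 (λ Q → con 28 :* Q :+ (Q :+ (con 3 :* Q :+ con 4 :* Q :+ con 4 :* Q :+ (con 30 :* Q :+ con 30 :* Q)))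
           :+ con 28 :* Q := con 128 :* Q) refl Q ⟩
    128 * Q ∎
    where
    open ≤-Reasoning
    L = LU + LN
    Q = L * B
    e = lu + wN
    1≤L : 1 ≤ L
    1≤L = ≤-trans 1≤LN (m≤n+m LN LU)
    L≤Q : L ≤ Q
    L≤Q = m≤m*n L B {{>-nonZero 0<B}}
    1≤Q : 1 ≤ Q
    1≤Q = ≤-trans 1≤L L≤Q
    q≤LN : q ≤ LN
    q≤LN = ≤-trans (m≤m+n q q) (⌊n/2⌋+⌊n/2⌋≤n LN)
    ℓ≤4L : ℓ ≤ 4 * L
    ℓ≤4L = begin
      suc LU + suc (suc q)      ≤⟨ +-monoʳ-≤ (suc LU) (s≤s (s≤s q≤LN)) ⟩
      suc LU + suc (suc LN)     ≡⟨ solve 2 (λ x y → (con 1 :+ x) :+ (con 2 :+ y) := con 3 :+ (x :+ y)) refl LU LN ⟩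
      3 + L                     ≤⟨ +-monoˡ-≤ L (*-monoʳ-≤ 3 1≤L) ⟩
      3 * L + L                 ≡⟨ solve 1 (λ x → con 3 :* x :+ x := con 4 :* x) refl L ⟩
      4 * L                     ∎
    wN≤2B : wN ≤ 2 * B
    wN≤2B = begin
      suc LN                    ≤⟨ s≤s (n≤1+⌊n/2⌋+⌊n/2⌋ LN) ⟩
      2 + (q + q)               ≡⟨ solve 1 (λ q → con 2 :+ (q :+ q) := con 2 :* (con 1 :+ q)) refl q ⟩
      2 * suc q                 ≤⟨ *-monoʳ-≤ 2 (n≤2^n (suc q)) ⟩
      2 * B                     ∎
    1+b≤7B : suc b ≤ 7 * B
    1+b≤7B = begin
      1 + wN * 3                ≤⟨ +-mono-≤ 0<B (*-monoˡ-≤ 3 wN≤2B) ⟩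
      B + 2 * B * 3             ≡⟨ solve 1 (λ B → B :+ con 2 :* B :* con 3 := con 7 :* B) refl B ⟩
      7 * B                     ∎
    product-≤ : ℓ * suc b ≤ 28 * Q
    product-≤ = begin
      ℓ * suc b                 ≤⟨ *-mono-≤ ℓ≤4L 1+b≤7B ⟩
      (4 * L) * (7 * B)         ≡⟨ solve 2 (λ L B → (con 4 :* L) :* (con 7 :* B) := con 28 :* (L :* B)) refl L B ⟩
      28 * Q                    ∎
    coins-≤ : ℓ * b ≤ 28 * Q
    coins-≤ = ≤-trans (*-monoʳ-≤ ℓ (n≤1+n b)) product-≤
    wN≤2Q : wN ≤ 2 * Q
    wN≤2Q = ≤-trans (≤-trans (+-mono-≤ 1≤L (m≤n+m LN LU)) (≤-reflexive (sym (2*m≡m+m L)))) (*-monoʳ-≤ 2 L≤Q)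
    sum-≤ : wN + ℓ * suc b ≤ 30 * Q
    sum-≤ = ≤-trans (+-mono-≤ wN≤2Q product-≤) (≤-reflexive (sym (*-distribʳ-+ Q 2 28)))
    e≤3L : e ≤ 3 * L
    e≤3L = begin
      suc LU + suc LN           ≡⟨ solve 2 (λ x y → (con 1 :+ x) :+ (con 1 :+ y) := con 2 :+ (x :+ y)) refl LU LN ⟩
      2 + L                     ≤⟨ +-monoˡ-≤ L (*-monoʳ-≤ 2 1≤L) ⟩
      2 * L + L                 ≡⟨ solve 1 (λ x → con 2 :* x :+ x := con 3 :* x) refl L ⟩
      3 * L                     ∎
    e≤3Q : e ≤ 3 * Q
    e≤3Q = ≤-trans e≤3L (*-monoʳ-≤ 3 L≤Q)
    list-≤ : B * suc e ≤ 4 * Q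
    list-≤ = begin
      B * suc e                 ≤⟨ *-monoʳ-≤ B (+-mono-≤ 1≤L e≤3L) ⟩
      B * (4 * L)               ≡⟨ solve 2 (λ L B → B :* (con 4 :* L) := con 4 :* (L :* B)) refl L B ⟩
      4 * Q                     ∎

  -- Passing from B to √N costs a factor 2, which turns 128 into 256.
  space-≤-·√ : .{{_ : NonZero N}} → 1 ≤ LN → space checker ≤ 256 * (LU + LN) ·√ N
  space-≤-·√ 1≤LN = begin
    space checker ^ 2          ≤⟨ ^-monoˡ-≤ 2 (space-≤ 1≤LN) ⟩
    (128 * (L * B)) ^ 2        ≡⟨ solve 2 (λ L B → (con 128 :* (L :* B)) :* ((con 128 :* (L :* B)) :* con 1) := (con 128 :* L) :* (con 128 :* L) :* (B :* B)) refl L B ⟩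
    (128 * L) * (128 * L) * (B * B)  ≤⟨ *-monoʳ-≤ ((128 * L) * (128 * L)) B²≤4N ⟩
    (128 * L) * (128 * L) * (4 * N)
      ≡⟨ solve 2 (λ L N → (con 128 :* L) :* (con 128 :* L) :* (con 4 :* N) :=
           ((con 256 :* L) :* ((con 256 :* L) :* con 1)) :* N) refl L N ⟩
    (256 * L) ^ 2 * N          ∎
    where
    open ≤-Reasoning
    L = LU + LN

-- For N = U = 1 the bound leaves no memory; no sequence of length 1 is in PQ, and
-- the error bound is void.
acceptor : ∀ {A} → StreamingAlgorithm A
acceptor = record { memory = 0 ; coins = 0 ; start = λ _ → [] ; step = λ _ _ _ → [] ; accept = λ _ → true }

algorithm : (N U : ℕ) → StreamingAlgorithm (Symbol U)
algorithm (suc (suc N)) (suc n) = Parameters.checker (suc (suc N)) n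
algorithm _             _       = acceptor

theorem4p5 : Σ ((N U : ℕ) → StreamingAlgorithm (Symbol U)) λ alg →
    ∃[ C ] ((N U : ℕ) .{{_ : NonZero N}} .{{_ : NonZero U}} →
    (space (alg N U) ≤ C * (⌊log₂ U ⌋ + ⌊log₂ N ⌋) ·√ N) ×
    ((σ : Vec (Symbol U) N) → PQ σ →
    ∀ r → run (alg N U) σ r ≡ true) ×
    ((σ : Vec (Symbol U) N) → ¬ PQ σ →
    1ℚᵘ - (_/_ (+ 1) (N ^ 2) {{m^n≢0 N 2}}) ℚ.≤ Pr (not ∘ run (alg N U) σ)))
theorem4p5 = algorithm , 256 , λ
  { (suc zero) U → z≤n , (λ { (y ∷ []) _ _ → refl }) , λ { σ@(y ∷ []) _ → Pr-not (run acceptor σ) 1 ≤-refl }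
  ; (suc (suc N)) (suc n) → let open Parameters (suc (suc N)) n in
      space-≤-·√ (⌊log₂⌋-mono-≤ {2} {suc (suc N)} (s≤s (s≤s z≤n))) ,
      accepts 0<B N≤B² fits-U fits-N ,
      λ σ ¬pq → Pr-not (run checker σ) (suc (suc N) ^ 2) {{m^n≢0 (suc (suc N)) 2}}
        (rejects 0<B N≤B² fits-U fits-N fits-tag rare σ ¬pq)
  }
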